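{- Let $P$ and $R$ be two general logic programs such that $P\cup R$ is well-typed and $P$ extends $R$, and let $M$ be a complete model of $P\cup R$. Suppose that (1) $P$ is acceptable with respect to a level mapping $|\ |$ and $M$; (2) every well-typed atom defined in $P$ is bounded with respect to $|\ |$; (3) for all well-typed queries $Q$, all LDNF-derivations of $R\cup\{Q\}$ are finite. Then for all well-typed queries $Q$, all LDNF-derivations of $(P\cup R)\cup\{Q\}$ are finite.
   Context: **Programs.** All programs and queries are over a fixed first-order language with at least one constant. A literal is an atom or a negated atom. A (general) clause is $H\leftarrow L_1,\ldots,L_n$ ($n\ge 0$), $H$ an atom, $L_i$ literals. A (general) query is a finite, possibly empty, sequence of literals. A (general) program is a finite set of clauses. $B_P$ is the set of ground atoms whose predicate symbol occurs in $P$; $\mathit{ground}(P)$ is the set of ground instances of clauses of $P$. **LDNF-resolution (leftmost selection rule).** For a program $P$ and a non-empty query $Q=L,\mathbf{L}$: (i) if $L=A$ is an atom, the resolvents of $Q$ are the queries $(\mathbf{B},\mathbf{L})\theta$ for $H\leftarrow\mathbf{B}$ a variant of a clause of $P$ renamed apart from $Q$ and $\theta=\mathrm{mgu}(A,H)$; (ii) if $L=\neg A$ with $A$ ground, a subsidiary LDNF-tree for $P\cup\{A\}$ is constructed; if this tree is finite and finitely failed, $Q$ has the single resolvent $\mathbf{L}$; if it is finite and has a successful branch, $Q$ fails; if its construction diverges, the derivation containing $Q$ is considered infinite; (iii) if $L=\neg A$ with $A$ non-ground, the derivation flounders: it ends (finitely) with no resolvent. A branch is successful if it ends in the empty query; it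 is failed if it ends in a query whose first literal is positive with no resolvent, or negative and ground with a finite subsidiary tree having a successful branch. A tree is finitely failed if it is finite and all its branches are failed. The branches of the LDNF-tree of $P\cup\{Q\}$ are its LDNF-derivations. "All LDNF-derivations of $P\cup\{Q\}$ are finite" means that the interpreter terminates: there is no infinite sequence $Q=Q_0,Q_1,Q_2,\ldots$ where each $Q_{k+1}$ is a resolvent of $Q_k$ or, if $Q_k$ begins with a ground negative literal $\neg A$, the root $A$ of its subsidiary tree. **Types.** A type is a set of terms closed under substitution. Every $n$-ary predicate $p$ has a fixed mode $m_p:\{1,\ldots,n\}\to\{+,-\}$ ($+$ input, $-$ output position) and a fixed assignment $t_p$ of a type to each position. A type judgement $\mathbf{s}:\mathbf{S}\Rightarrow\mathbf{t}:\mathbf{T}$ is true, written $\models\mathbf{s}:\mathbf{S}\Rightarrow\mathbf{t}:\mathbf{T}$, if for all substitutions $\theta$, $\mathbf{s}\theta\in\mathbf{S}$ implies $\mathbf{t}\theta\in\mathbf{T}$ (componentwise). For a literal $L_s$ (positive or negative), $\mathbf{i}_s:\mathbf{I}_s$ and $\mathbf{o}_s:\mathbf{O}_s$ denote the sequences of terms, with the associated types, in its input and output positions. A query $L_1,\ldots,L_n$ is well-typed if for all $j\in\{1,\ldots,n\}$, $\models\mathbf{o}_{j_1}:\mathbf{O}_{j_1},\ldots,\mathbf{o}_{j_k}:\mathbf{O}_{j_k}\Rightarrow\mathbf{i}_j:\mathbf{I}_j$, where $L_{j_1},\ldots,L_{j_k}$ are all the positive literals in $L_1,\ldots,L_{j-1}$.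 A clause $L_0\leftarrow L_1,\ldots,L_n$ is well-typed if for all $j\in\{1,\ldots,n\}$, $\models\mathbf{i}_0:\mathbf{I}_0,\mathbf{o}_{j_1}:\mathbf{O}_{j_1},\ldots,\mathbf{o}_{j_k}:\mathbf{O}_{j_k}\Rightarrow\mathbf{i}_j:\mathbf{I}_j$, where $L_{j_1},\ldots,L_{j_k}$ are all the positive literals in $L_1,\ldots,L_{j-1}$, and moreover $\models\mathbf{i}_0:\mathbf{I}_0,\mathbf{o}_{j_1}:\mathbf{O}_{j_1},\ldots,\mathbf{o}_{j_h}:\mathbf{O}_{j_h}\Rightarrow\mathbf{o}_0:\mathbf{O}_0$, where $L_{j_1},\ldots,L_{j_h}$ are all the positive literals in $L_1,\ldots,L_n$. A program is well-typed if all its clauses are. A well-typed atom is an atom which is well-typed as a one-literal query. **Level mappings, boundedness.** A level mapping for $P$ is a function $|\ |:B_P\to\mathbf{N}$, extended to ground literals by $|\neg A|=|A|$. An atom $A$ is bounded w.r.t. $|\ |$ if $\{|A'| : A' \text{ a ground instance of } A\}$ is finite. **Complete model.** $p$ refers to $q$ if some clause of $P$ has $p$ in its head and $q$ in its body; "depends on" is the reflexive transitive closure of "refers to". $\mathit{Neg}_P$ is the set of relations occurring in a negative literal in a clause of $P$; $\mathit{Neg}^*_P$ is the set of relations on which relations in $\mathit{Neg}_P$ depend; $P^-$ is the set of clauses of $P$ defining relations in $\mathit{Neg}^*_P$. A model $M$ of $P$ is complete if its restriction to the relations in $\mathit{Neg}^*_P$ is a model of Clark's completion $\mathit{comp}(P^-)$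 (with the free equality axioms; a relation in $\mathit{Neg}^*_P$ having no clauses is completed by $\forall \mathbf{x}\,\neg p(\mathbf{x})$). **Acceptability.** Let $|\ |$ be a level mapping for $P$ and $M$ a complete model (here: of the whole program $P\cup R$). $P$ is acceptable w.r.t. $|\ |$ and $M$ if for every clause $A\leftarrow\mathbf{A},B,\mathbf{B}$ in $\mathit{ground}(P)$ (with $B$ a literal and $\mathbf{A},\mathbf{B}$ sequences of literals): if $M\models\mathbf{A}$ then $|A|>|B|$. **Extension.** A relation is defined in $P$ if it occurs in the head of a clause of $P$; an atom is defined in $P$ if its predicate symbol is. $P$ extends $R$ if no relation defined in $P$ occurs in $R$. -}

module Defs where

open import Data.Empty using (⊥)
open import Data.Fin using (Fin)
open import Data.List using (List; []; _∷_; _++_; map; concatMap; filter; allFin)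
open import Data.List.Membership.Propositional using (_∈_)
open import Data.List.Relation.Binary.Disjoint.Propositional using (Disjoint)
open import Data.List.Relation.Unary.All using (All)
open import Data.Nat using (ℕ; _<_)
open import Data.Product using (∃-syntax; _×_; _,_)
open import Data.Unit using (⊤)
open import Data.Vec using (Vec; []; _∷_; lookup)
open import Function using (flip)
open import Function.Bundles using (_⇔_)
open import Induction.InfiniteDescent using (InfiniteDescendingSequenceFrom)
open import Relation.Binary.Construct.Closure.ReflexiveTransitive using (Star)
open import Relation.Binary.Definitions using (DecidableEquality)
open import Relation.Binary.PropositionalEquality using (_≡_; _≢_; refl)
open import Relation.Nullary using (¬_; yes; no)

record Language : Set₁ where
  field
    Function       : Set
    functionArity  : Function → ℕ
    Relation       : Set
    relationArity  : Relation → ℕ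
    constant       : Function
    constant-arity : functionArity constant ≡ 0

data Mode : Set where
  input output : Mode

_≟ᵐ_ : DecidableEquality Mode
input  ≟ᵐ input  = yes refl
input  ≟ᵐ output = no λ ()
output ≟ᵐ input  = no λ ()
output ≟ᵐ output = yes refl

module LogicPrograms (𝓛 : Language) where

  open Language 𝓛

  Var : Set
  Var = ℕ

  data Term : Set where
    var : Var → Term
    fn  : (f : Function) → Vec Term (functionArity f) → Term

  record Atom : Set where
    constructor _∙_
    field
      relation  : Relation
      arguments : Vec Term (relationArity relation)

  open Atom public

  data Literal : Set where
    pos neg : Atom → Literal

  atomOf : Literal → Atom
  atomOf (pos A) = A
  atomOf (neg A) = A

  Query : Set
  Query = List Literal

  infix 4 _⟵_

  record Clause : Set where
    constructor _⟵_
    field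
      head : Atom
      body : Query

  open Clause public

  Program : Set
  Program = List Clause

  varsᵗ  : Term → List Var
  varsᵗˢ : ∀ {n} → Vec Term n → List Var
  varsᵗ (var x)    = x ∷ []
  varsᵗ (fn f ts)  = varsᵗˢ ts
  varsᵗˢ []        = []
  varsᵗˢ (t ∷ ts)  = varsᵗ t ++ varsᵗˢ ts

  varsᵃ : Atom → List Var
  varsᵃ A = varsᵗˢ (arguments A)

  varsᵠ : Query → List Var
  varsᵠ = concatMap λ L → varsᵃ (atomOf L)

  varsᶜ : Clause → List Var
  varsᶜ (H ⟵ 𝐁) = varsᵃ H ++ varsᵠ 𝐁

  Ground : Atom → Set
  Ground A = varsᵃ A ≡ []

  -- Finite domain is not required: a term has finitely many variables, so
  -- the instances of an expression, and the resolvents computed from most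
  -- general unifiers, are the same with and without this requirement.
  Substitution : Set
  Substitution = Var → Term

  infixl 8 _[_]ᵗ _[_]ᵗˢ _[_]ᵃ _[_]ˡ _[_]ᵠ _[_]ᶜ

  _[_]ᵗ  : Term → Substitution → Term
  _[_]ᵗˢ : ∀ {n} → Vec Term n → Substitution → Vec Term n
  var x [ θ ]ᵗ      = θ x
  fn f ts [ θ ]ᵗ    = fn f (ts [ θ ]ᵗˢ)
  [] [ θ ]ᵗˢ        = []
  (t ∷ ts) [ θ ]ᵗˢ  = t [ θ ]ᵗ ∷ ts [ θ ]ᵗˢ

  _[_]ᵃ : Atom → Substitution → Atom
  (p ∙ ts) [ θ ]ᵃ = p ∙ (ts [ θ ]ᵗˢ)

  _[_]ˡ : Literal → Substitution → Literal
  pos A [ θ ]ˡ = pos (A [ θ ]ᵃ)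
  neg A [ θ ]ˡ = neg (A [ θ ]ᵃ)

  _[_]ᵠ : Query → Substitution → Query
  Q [ θ ]ᵠ = map _[ θ ]ˡ Q

  _[_]ᶜ : Clause → Substitution → Clause
  (H ⟵ 𝐁) [ θ ]ᶜ = H [ θ ]ᵃ ⟵ 𝐁 [ θ ]ᵠ

  Variant : Clause → Clause → Set
  Variant c c′ = (∃[ σ ] c′ ≡ c [ σ ]ᶜ) × (∃[ τ ] c ≡ c′ [ τ ]ᶜ)

  record IsMgu (θ : Substitution) (A B : Atom) : Set where
    field
      unifies     : A [ θ ]ᵃ ≡ B [ θ ]ᵃ
      mostGeneral : ∀ σ → A [ σ ]ᵃ ≡ B [ σ ]ᵃ →
                    ∃[ γ ] (∀ x → σ x ≡ θ x [ γ ]ᵗ)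

  _∈ground_ : Clause → Program → Set
  c′ ∈ground P =
    ∃[ c ] c ∈ P × (∃[ θ ] c′ ≡ c [ θ ]ᶜ) × varsᶜ c′ ≡ []

  data _OccursInClause_ (p : Relation) (c : Clause) : Set where
    in-head : relation (head c) ≡ p → p OccursInClause c
    in-body : ∀ {L} → L ∈ body c → relation (atomOf L) ≡ p → p OccursInClause c

  _OccursIn_ : Relation → Program → Set
  p OccursIn P = ∃[ c ] c ∈ P × p OccursInClause c

  _DefinedIn_ : Relation → Program → Set
  p DefinedIn P = ∃[ c ] c ∈ P × relation (head c) ≡ p

  _Extends_ : Program → Program → Set
  P Extends R = ∀ p → p DefinedIn P → ¬ (p OccursIn R)

  RefersTo : Program → Relation → Relation → Set
  RefersTo P p q =
    ∃[ c ] c ∈ P × relation (head c) ≡ p ×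
      (∃[ L ] L ∈ body c × relation (atomOf L) ≡ q)

  DependsOn : Program → Relation → Relation → Set
  DependsOn P = Star (RefersTo P)

  Neg : Program → Relation → Set
  Neg P p = ∃[ c ] c ∈ P × (∃[ A ] neg A ∈ body c × relation A ≡ p)

  Neg* : Program → Relation → Set
  Neg* P p = ∃[ q ] Neg P q × DependsOn P q p

  _∈_⁻ : Clause → Program → Set
  c ∈ P ⁻ = c ∈ P × Neg* P (relation (head c))

  record PositiveResolvent (P : Program) (A : Atom) (𝐋 Q′ : Query) : Set where
    field
      clause       : Clause
      clause∈P     : clause ∈ P
      variant      : Clause
      isVariant    : Variant clause variant
      renamedApart : Disjoint (varsᶜ variant) (varsᵠ (pos A ∷ 𝐋))
      θ            : Substitution
      isMgu        : IsMgu θ A (head variant)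
      resolvent    : Q′ ≡ (body variant ++ 𝐋) [ θ ]ᵠ

  -- An element of LDNFTree P Q is a finite LDNF-tree for P ∪ {Q}.  A node
  -- selecting a positive literal has a child for every choice of variant and
  -- mgu; up to renaming there is at most one child per clause of P, so that a
  -- tree is finite (up to renaming) exactly when it is well-founded.
  data LDNFTree (P : Program) : Query → Set
  FinitelyFailed : ∀ {P Q} → LDNFTree P Q → Set
  HasSuccess     : ∀ {P Q} → LDNFTree P Q → Set

  data LDNFTree P where
    success  : LDNFTree P []
    positive : ∀ {A 𝐋} →
               (∀ Q′ → PositiveResolvent P A 𝐋 Q′ → LDNFTree P Q′) →
               LDNFTree P (pos A ∷ 𝐋)
    flounder : ∀ {A 𝐋} → ¬ Ground A → LDNFTree P (neg A ∷ 𝐋)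
    continue : ∀ {A 𝐋} → Ground A →
               (t : LDNFTree P (pos A ∷ [])) → FinitelyFailed t →
               LDNFTree P 𝐋 → LDNFTree P (neg A ∷ 𝐋)
    -- The subsidiary tree has a successful branch, or else it has neither a
    -- successful branch nor only failed ones (a branch flounders); either way
    -- there is no resolvent, but only in the first case is the node failed.
    stop     : ∀ {A 𝐋} → Ground A →
               (t : LDNFTree P (pos A ∷ [])) → ¬ FinitelyFailed t →
               LDNFTree P (neg A ∷ 𝐋)

  FinitelyFailed success            = ⊥
  FinitelyFailed (positive ts)      = ∀ Q′ r → FinitelyFailed (ts Q′ r)
  FinitelyFailed (flounder _)       = ⊥
  FinitelyFailed (continue _ _ _ t) = FinitelyFailed t
  FinitelyFailed (stop _ t _)       = HasSuccess t

  HasSuccess success            = ⊤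
  HasSuccess (positive ts)      = ∃[ Q′ ] ∃[ r ] HasSuccess (ts Q′ r)
  HasSuccess (flounder _)       = ⊥
  HasSuccess (continue _ _ _ t) = HasSuccess t
  HasSuccess (stop _ _ _)       = ⊥

  data Resolvent (P : Program) : Query → Query → Set where
    positive : ∀ {A 𝐋 Q′} → PositiveResolvent P A 𝐋 Q′ →
               Resolvent P (pos A ∷ 𝐋) Q′
    negative : ∀ {A 𝐋} → Ground A →
               (t : LDNFTree P (pos A ∷ [])) → FinitelyFailed t →
               Resolvent P (neg A ∷ 𝐋) 𝐋

  data Step (P : Program) : Query → Query → Set where
    resolvent  : ∀ {Q Q′} → Resolvent P Q Q′ → Step P Q Q′
    subsidiary : ∀ {A 𝐋} → Ground A → Step P (neg A ∷ 𝐋) (pos A ∷ [])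

  AllDerivationsFinite : Program → Query → Set
  AllDerivationsFinite P Q =
    ¬ (∃[ s ] InfiniteDescendingSequenceFrom (flip (Step P)) s Q)

  record Structure : Set₁ where
    field
      Domain : Set
      ⟦_⟧ᶠ   : (f : Function) → Vec Domain (functionArity f) → Domain
      ⟦_⟧ʳ   : (p : Relation) → Vec Domain (relationArity p) → Set

  module _ (M : Structure) where

    open Structure M

    Assignment : Set
    Assignment = Var → Domain

    evalᵗ  : Assignment → Term → Domain
    evalᵗˢ : ∀ {n} → Assignment → Vec Term n → Vec Domain n
    evalᵗ  v (var x)    = v x
    evalᵗ  v (fn f ts)  = ⟦ f ⟧ᶠ (evalᵗˢ v ts)
    evalᵗˢ v []         = []
    evalᵗˢ v (t ∷ ts)   = evalᵗ v t ∷ evalᵗˢ v ts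

    TrueAtom : Assignment → Atom → Set
    TrueAtom v (p ∙ ts) = ⟦ p ⟧ʳ (evalᵗˢ v ts)

    TrueLiteral : Assignment → Literal → Set
    TrueLiteral v (pos A) = TrueAtom v A
    TrueLiteral v (neg A) = ¬ TrueAtom v A

    TrueQuery : Assignment → Query → Set
    TrueQuery v = All (TrueLiteral v)

    -- Truth of the universal closure.
    _⊨_ : Query → Set
    _⊨_ Q = ∀ v → TrueQuery v Q

    IsModel : Program → Set
    IsModel P = ∀ {c} → c ∈ P → ∀ v → TrueQuery v (body c) → TrueAtom v (head c)

    -- Equality is interpreted as identity on the domain.
    record FreeEquality : Set where
      field
        injective  : ∀ f {ds es} → ⟦ f ⟧ᶠ ds ≡ ⟦ f ⟧ᶠ es → ds ≡ es
        distinct   : ∀ {f g} → f ≢ g → ∀ ds es → ⟦ f ⟧ᶠ ds ≢ ⟦ g ⟧ᶠ es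
        occurCheck : ∀ {x t} → x ∈ varsᵗ t → t ≢ var x →
                     ∀ v → v x ≢ evalᵗ v t

    -- p(x₁,…,xₙ) ↔ ⋁ ∃y₁…yₘ (x₁ = t₁ ∧ … ∧ xₙ = tₙ ∧ 𝐁), where the disjunction
    -- ranges over the clauses p(t₁,…,tₙ) ⟵ 𝐁 of P⁻ and y₁,…,yₘ are the
    -- variables of the clause; the empty disjunction is false.
    CompletedDefinition : Program → Relation → Set
    CompletedDefinition P p = ∀ ds →
      ⟦ p ⟧ʳ ds ⇔
      (∃[ ts ] ∃[ 𝐁 ] (p ∙ ts ⟵ 𝐁) ∈ P ⁻ ×
        (∃[ v ] ds ≡ evalᵗˢ v ts × TrueQuery v 𝐁))

    -- comp(P⁻) only mentions relations in Neg* P, hence it may be evaluated in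
    -- M instead of in the restriction of M.
    record IsCompleteModel (P : Program) : Set where
      field
        isModel      : IsModel P
        freeEquality : FreeEquality
        completion   : ∀ p → Neg* P p → CompletedDefinition P p

  record HerbrandBase (P : Program) : Set where
    constructor mkHerbrand
    field
      atom      : Atom
      .ground   : Ground atom
      .occurs   : relation atom OccursIn P

  open HerbrandBase public

  LevelMapping : Program → Set
  LevelMapping P = HerbrandBase P → ℕ

  Bounded : (P : Program) → LevelMapping P → Atom → Set
  Bounded P ∣_∣ A =
    ∃[ ns ] (∀ (A′ : HerbrandBase P) → (∃[ θ ] atom A′ ≡ A [ θ ]ᵃ) → ∣ A′ ∣ ∈ ns)

  -- The extension |¬B| = |B| is expressed by taking the atom of the literal.
  Acceptable : (P : Program) → LevelMapping P → Structure → Set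
  Acceptable P ∣_∣ M =
    ∀ (A B : HerbrandBase P) 𝐀 L 𝐁 → atomOf L ≡ atom B →
    (atom A ⟵ 𝐀 ++ L ∷ 𝐁) ∈ground P → _⊨_ M 𝐀 → ∣ B ∣ < ∣ A ∣

  record Type : Set₁ where
    field
      Member : Term → Set
      closed : ∀ t θ → Member t → Member (t [ θ ]ᵗ)

  open Type public

  record Typing : Set₁ where
    field
      mode : (p : Relation) → Fin (relationArity p) → Mode
      type : (p : Relation) → Fin (relationArity p) → Type

  TypedTerms : Set₁
  TypedTerms = List (Term × Type)

  InstanceMember : Substitution → Term × Type → Set
  InstanceMember θ (t , T) = Member T (t [ θ ]ᵗ)

  ⊨_⇒_ : TypedTerms → TypedTerms → Set₁
  ⊨ Γ ⇒ Δ = ∀ θ → All (InstanceMember θ) Γ → All (InstanceMember θ) Δ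

  module WellTyping (𝓣 : Typing) where

    open Typing 𝓣

    positions : Mode → Atom → TypedTerms
    positions m (p ∙ ts) =
      map (λ i → lookup ts i , type p i)
          (filter (λ i → mode p i ≟ᵐ m) (allFin (relationArity p)))

    inputs outputs : Atom → TypedTerms
    inputs  = positions input
    outputs = positions output

    positiveOutputs : Query → TypedTerms
    positiveOutputs = concatMap λ where
      (pos A) → outputs A
      (neg A) → []

    WellTypedQuery : Query → Set₁
    WellTypedQuery Q = ∀ 𝐀 L 𝐁 → Q ≡ 𝐀 ++ L ∷ 𝐁 →
      ⊨ positiveOutputs 𝐀 ⇒ inputs (atomOf L)

    record WellTypedClause (c : Clause) : Set₁ where
      field
        bodyInputs  : ∀ 𝐀 L 𝐁 → body c ≡ 𝐀 ++ L ∷ 𝐁 →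
                      ⊨ inputs (head c) ++ positiveOutputs 𝐀 ⇒ inputs (atomOf L)
        headOutputs : ⊨ inputs (head c) ++ positiveOutputs (body c)
                        ⇒ outputs (head c)

    WellTypedProgram : Program → Set₁
    WellTypedProgram P = ∀ {c} → c ∈ P → WellTypedClause c

    WellTypedAtom : Atom → Set₁
    WellTypedAtom A = WellTypedQuery (pos A ∷ [])

{-# OPTIONS --safe #-}

-- Well-typedness is preserved by resolution, and a derivation of 𝐀 ++ 𝐁 follows
-- derivations of 𝐀 until 𝐀 has been resolved completely; hence it suffices that
-- the well-typed atoms terminate.  A derivation of an atom not defined in P only
-- uses clauses of R.  For an atom defined in P one argues by induction on a bound
-- for the levels of its ground instances: when a body literal L of a clause is
-- selected, the literals before it have been resolved and are true in M, so that
-- by acceptability L lies below the head.  That resolved literals are true in M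
-- needs the soundness of finite failure with respect to Clark's completion, and
-- this in turn the existence of most general unifiers.  All of this is used to
-- derive a contradiction from an infinite derivation, so that the undecidable
-- case distinctions may be made under a double negation.

module Submission where

open import Defs
open import Data.Fin using (zero; suc)
open import Data.List using (List; []; _∷_; _++_; length; filter)
open import Data.List.Extrema.Nat using (max; xs≤max)
open import Data.List.Membership.DecPropositional using () renaming (_∈?_ to mem?)
open import Data.List.Membership.Propositional using (_∈_; _∉_)
open import Data.List.Membership.Propositional.Properties
  using (∈-++⁺ˡ; ∈-++⁺ʳ; ∈-++⁻; ∈-filter⁺)
open import Data.List.Properties
  using (filter-notAll; concatMap-++; length-map; map-++; ++-assoc; ++-identityʳ; ++-conicalˡ;
         ≡-dec)
open import Data.List.Relation.Binary.Disjoint.Propositional using (Disjoint)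
open import Data.List.Relation.Binary.Subset.Propositional using (_⊆_)
open import Data.List.Relation.Unary.All as All using (All; []; _∷_)
import Data.List.Relation.Unary.All.Properties as Allₚ
open import Data.List.Relation.Unary.Any as Any using (here; there)
open import Data.Nat using (ℕ; zero; suc; _+_; _∸_; _<_; _<?_; s≤s; s≤s⁻¹; _≟_)
open import Data.Nat.Properties using (≤-refl; ≤-trans; +-assoc; m+n≮m; m+n∸m≡n)
open import Data.Product using (∃-syntax; _×_; _,_; proj₁; proj₂)
open import Data.Sum using (inj₁; inj₂; [_,_]′)
open import Data.Unit.Polymorphic using (⊤; tt)
open import Data.Vec as Vec using (Vec; []; _∷_)
open import Data.Vec.Properties using (∷-injectiveˡ; ∷-injectiveʳ; ++-injectiveˡ; ++-injectiveʳ)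
open import Function using (_∘_; id; flip; case_of_)
open import Function.Bundles using (_⇔_; mk⇔; Equivalence)
open import Induction.InfiniteDescent using (InfiniteDescendingSequenceFrom)
open import Relation.Binary.Construct.Closure.ReflexiveTransitive using (_◅_; _◅◅_; ε)
open import Relation.Binary.PropositionalEquality
  using (_≡_; _≢_; refl; sym; trans; cong; cong₂; subst)
open import Relation.Nullary using (¬_; yes; no; ¬?; recompute)
open import Relation.Nullary.Decidable using (¬¬-excluded-middle)
open import Relation.Nullary.Negation using (¬¬-map; contradiction)

-- Substitutions and evaluation in a structure.

module Substitutions (𝓛 : Language) where

  open Language 𝓛
  open LogicPrograms 𝓛

  infixl 9 _⨟_

  _⨟_ : Substitution → Substitution → Substitution
  (σ ⨟ τ) x = σ x [ τ ]ᵗ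

  -- Evaluation here under `σ` is application of `σ`, so that laws of substitution are instances of
  -- laws of evaluation.
  Herbrand : Structure
  Herbrand = record { Domain = Term ; ⟦_⟧ᶠ = fn ; ⟦_⟧ʳ = λ _ _ → Term }

  module _ (N : Structure) where

    open Structure N

    eval-cong : ∀ {v w} t → (∀ {x} → x ∈ varsᵗ t → v x ≡ w x) →
                evalᵗ N v t ≡ evalᵗ N w t
    eval-congˢ : ∀ {n v w} (ts : Vec Term n) → (∀ {x} → x ∈ varsᵗˢ ts → v x ≡ w x) →
                 evalᵗˢ N v ts ≡ evalᵗˢ N w ts
    eval-cong (var x)    h = h (here refl)
    eval-cong (fn f ts)  h = cong ⟦ f ⟧ᶠ (eval-congˢ ts h)
    eval-congˢ []        h = refl
    eval-congˢ (t ∷ ts)  h =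
      cong₂ _∷_ (eval-cong t (h ∘ ∈-++⁺ˡ)) (eval-congˢ ts (h ∘ ∈-++⁺ʳ (varsᵗ t)))

    eval-subst : ∀ {v w σ} → (∀ x → evalᵗ N v (σ x) ≡ w x) →
                 ∀ t → evalᵗ N v (t [ σ ]ᵗ) ≡ evalᵗ N w t
    eval-substˢ : ∀ {n v w σ} → (∀ x → evalᵗ N v (σ x) ≡ w x) →
                  ∀ (ts : Vec Term n) → evalᵗˢ N v (ts [ σ ]ᵗˢ) ≡ evalᵗˢ N w ts
    eval-subst  h (var x)    = h x
    eval-subst  h (fn f ts)  = cong ⟦ f ⟧ᶠ (eval-substˢ h ts)
    eval-substˢ h []         = refl
    eval-substˢ h (t ∷ ts)   = cong₂ _∷_ (eval-subst h t) (eval-substˢ h ts)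

    eval-++ : ∀ {m n v} (ss : Vec Term m) (ts : Vec Term n) →
              evalᵗˢ N v (ss Vec.++ ts) ≡ evalᵗˢ N v ss Vec.++ evalᵗˢ N v ts
    eval-++ []       ts = refl
    eval-++ (s ∷ ss) ts = cong (_ ∷_) (eval-++ ss ts)

  subst-as-eval : ∀ {σ} t → evalᵗ Herbrand σ t ≡ t [ σ ]ᵗ
  subst-as-evalˢ : ∀ {n σ} (ts : Vec Term n) → evalᵗˢ Herbrand σ ts ≡ ts [ σ ]ᵗˢ
  subst-as-eval  (var x)   = refl
  subst-as-eval  (fn f ts) = cong (fn f) (subst-as-evalˢ ts)
  subst-as-evalˢ []        = refl
  subst-as-evalˢ (t ∷ ts)  = cong₂ _∷_ (subst-as-eval t) (subst-as-evalˢ ts)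

  subst-cong : ∀ {n σ τ} (ts : Vec Term n) → (∀ {x} → x ∈ varsᵗˢ ts → σ x ≡ τ x) →
               ts [ σ ]ᵗˢ ≡ ts [ τ ]ᵗˢ
  subst-cong ts h =
    trans (sym (subst-as-evalˢ ts)) (trans (eval-congˢ Herbrand ts h) (subst-as-evalˢ ts))

  subst-subst : ∀ {σ τ} t → t [ σ ]ᵗ [ τ ]ᵗ ≡ t [ σ ⨟ τ ]ᵗ
  subst-subst {σ} {τ} t =
    trans (sym (subst-as-eval (t [ σ ]ᵗ)))
          (trans (eval-subst Herbrand (subst-as-eval ∘ σ) t) (subst-as-eval t))

  subst-substˢ : ∀ {n σ τ} (ts : Vec Term n) → ts [ σ ]ᵗˢ [ τ ]ᵗˢ ≡ ts [ σ ⨟ τ ]ᵗˢ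
  subst-substˢ []       = refl
  subst-substˢ (t ∷ ts) = cong₂ _∷_ (subst-subst t) (subst-substˢ ts)

  subst-var : ∀ {n} (ts : Vec Term n) → ts [ var ]ᵗˢ ≡ ts
  subst-varᵗ : ∀ t → t [ var ]ᵗ ≡ t
  subst-var []          = refl
  subst-var (t ∷ ts)    = cong₂ _∷_ (subst-varᵗ t) (subst-var ts)
  subst-varᵗ (var x)    = refl
  subst-varᵗ (fn f ts)  = cong (fn f) (subst-var ts)

  vars-subst : ∀ {n σ y} (ts : Vec Term n) → y ∈ varsᵗˢ (ts [ σ ]ᵗˢ) →
               ∃[ x ] x ∈ varsᵗˢ ts × y ∈ varsᵗ (σ x)
  vars-substᵗ : ∀ {σ y} t → y ∈ varsᵗ (t [ σ ]ᵗ) →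
                ∃[ x ] x ∈ varsᵗ t × y ∈ varsᵗ (σ x)
  vars-substᵗ (var x)   y∈ = x , here refl , y∈
  vars-substᵗ (fn f ts) y∈ = vars-subst ts y∈
  vars-subst {σ = σ} (t ∷ ts) y∈ with ∈-++⁻ (varsᵗ (t [ σ ]ᵗ)) y∈
  ... | inj₁ y∈t  = let x , x∈ , y∈σx = vars-substᵗ t y∈t in x , ∈-++⁺ˡ x∈ , y∈σx
  ... | inj₂ y∈ts = let x , x∈ , y∈σx = vars-subst ts y∈ts in x , ∈-++⁺ʳ (varsᵗ t) x∈ , y∈σx

-- Most general unifiers.

module Unification (𝓛 : Language) where

  open Language 𝓛
  open LogicPrograms 𝓛
  open Substitutions 𝓛

  Injective : Structure → Set
  Injective N = ∀ f {ds es} → ⟦ f ⟧ᶠ ds ≡ ⟦ f ⟧ᶠ es → ds ≡ es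
    where open Structure N

  Solves : ∀ {n} (N : Structure) → Assignment N → Vec Term n → Vec Term n → Set
  Solves N v ss ts = evalᵗˢ N v ss ≡ evalᵗˢ N v ts

  -- The quantification over N covers both the syntactic solutions, which are
  -- those in Herbrand, and the solutions in the model.
  record Mgu {n} (ss ts : Vec Term n) : Set₁ where
    field
      θ        : Substitution
      unifies  : Solves Herbrand θ ss ts
      general  : ∀ N → Injective N → ∀ v → Solves N v ss ts →
                 ∀ x → v x ≡ evalᵗ N v (θ x)

  herbrand-injective : Injective Herbrand
  herbrand-injective f refl = refl

  -- The same `θ` serves: the equivalence is used in `Herbrand` for `unifies` and in an arbitrary
  -- structure for `general`.
  mgu-resp : ∀ {m n} {ss ts : Vec Term m} {ss′ ts′ : Vec Term n} →
             (∀ N → Injective N → ∀ v → Solves N v ss ts ⇔ Solves N v ss′ ts′) →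
             Mgu ss ts → Mgu ss′ ts′
  mgu-resp eq μ = record
    { θ       = θ
    ; unifies = Equivalence.to (eq Herbrand herbrand-injective θ) unifies
    ; general = λ N inj v s → general N inj v (Equivalence.from (eq N inj v) s)
    }
    where open Mgu μ

  infix 10 _↦_

  _↦_ : Var → Term → Substitution
  (x ↦ t) y with y ≟ x
  ... | yes _ = t
  ... | no  _ = var y

  ↦-eq : ∀ x t → (x ↦ t) x ≡ t
  ↦-eq x t with x ≟ x
  ... | yes _  = refl
  ... | no x≢x = contradiction refl x≢x

  ↦-neq : ∀ {x y} t → y ≢ x → (x ↦ t) y ≡ var y
  ↦-neq {x} {y} t y≢x with y ≟ x
  ... | yes y≡x = contradiction y≡x y≢x
  ... | no  _   = refl

  -- Keeps a solution alive when `x` is eliminated: replacing `x` by `t` is invisible to an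
  -- assignment that solves their equation.
  ↦-eval : ∀ N v {x t} → v x ≡ evalᵗ N v t → ∀ y → evalᵗ N v ((x ↦ t) y) ≡ v y
  ↦-eval N v {x} eq y with y ≟ x
  ... | yes refl = sym eq
  ... | no  _    = refl

  mgu-eliminate : ∀ {n x t} {ss ts : Vec Term n} → x ∉ varsᵗ t →
                  Mgu (ss [ x ↦ t ]ᵗˢ) (ts [ x ↦ t ]ᵗˢ) → Mgu (var x ∷ ss) (t ∷ ts)
  mgu-eliminate {x = x} {t} {ss} {ts} x∉t μ = record
    { θ       = x ↦ t ⨟ θ
    ; unifies = cong₂ _∷_
        -- Both sides become `t [ θ ]ᵗ`: as `x` does not occur in `t`, the binding leaves `t` alone.
        (trans (cong _[ θ ]ᵗ (↦-eq x t)) (trans (sym (subst-as-eval t))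
          (eval-cong Herbrand t λ y∈t →
            sym (cong _[ θ ]ᵗ (↦-neq t λ { refl → x∉t y∈t })))))
        (trans (sym (shift ss)) (trans unifies (shift ts)))
    ; general = λ N inj v s y →
        let e  = ↦-eval N v (∷-injectiveˡ s)
            s′ = trans (eval-substˢ N e ss) (trans (∷-injectiveʳ s) (sym (eval-substˢ N e ts)))
        in trans (sym (e y))
                 (sym (eval-subst N (sym ∘ general N inj v s′) ((x ↦ t) y)))
    }
    where
    open Mgu μ
    shift : ∀ {n} (us : Vec Term n) →
            evalᵗˢ Herbrand θ (us [ x ↦ t ]ᵗˢ) ≡ evalᵗˢ Herbrand (x ↦ t ⨟ θ) us
    shift = eval-substˢ Herbrand (subst-as-eval ∘ (x ↦ t))

  size : Term → ℕ
  sizeˢ : ∀ {n} → Vec Term n → ℕ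
  size (var x)     = 1
  size (fn f ts)   = suc (sizeˢ ts)
  sizeˢ []         = 0
  sizeˢ (t ∷ ts)   = size t + sizeˢ ts

  sizeˢ-++ : ∀ {m n} (ss : Vec Term m) (ts : Vec Term n) →
             sizeˢ (ss Vec.++ ts) ≡ sizeˢ ss + sizeˢ ts
  sizeˢ-++ []       ts = refl
  sizeˢ-++ (s ∷ ss) ts =
    trans (cong (size s +_) (sizeˢ-++ ss ts)) (sym (+-assoc (size s) _ _))

  varsᵗˢ-++⁻ : ∀ {m n x} (ss : Vec Term m) {ts : Vec Term n} →
               x ∈ varsᵗˢ (ss Vec.++ ts) → x ∈ varsᵗˢ ss ++ varsᵗˢ ts
  varsᵗˢ-++⁻ []       x∈ = x∈
  varsᵗˢ-++⁻ (s ∷ ss) {ts} x∈ with ∈-++⁻ (varsᵗ s) x∈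
  ... | inj₁ x∈s = ∈-++⁺ˡ (∈-++⁺ˡ x∈s)
  ... | inj₂ x∈ss with ∈-++⁻ (varsᵗˢ ss) (varsᵗˢ-++⁻ ss x∈ss)
  ...   | inj₁ p = ∈-++⁺ˡ (∈-++⁺ʳ (varsᵗ s) p)
  ...   | inj₂ q = ∈-++⁺ʳ (varsᵗ s ++ varsᵗˢ ss) q

  _⟍_ : List Var → Var → List Var
  V ⟍ x = filter (λ y → ¬? (y ≟ x)) V

  ↦-vars : ∀ {n V x t} (ts : Vec Term n) → x ∉ varsᵗ t → varsᵗ t ⊆ V → varsᵗˢ ts ⊆ V →
           varsᵗˢ (ts [ x ↦ t ]ᵗˢ) ⊆ V ⟍ x
  ↦-vars {x = x} ts x∉t t⊆V ts⊆V y∈ with vars-subst ts y∈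
  ... | z , z∈ , y∈z with z ≟ x
  ...   | yes refl = ∈-filter⁺ _ (t⊆V y∈z) λ { refl → x∉t y∈z }
  ...   | no z≢x with y∈z
  ...     | here refl = ∈-filter⁺ _ (ts⊆V z∈) z≢x

  -- Failure of unification is ruled out by a solution in a model of the free
  -- equality axioms.  Since the function symbols need not have decidable
  -- equality, an mgu is only obtained up to double negation.
  module _ (N : Structure) (free : FreeEquality N) (v : Assignment N) where

    open FreeEquality free

    -- A solution in `N` excludes that `x` occurs in `t`, by `occurCheck`. The recursive call is
    -- passed in as `rec`, so that all elimination cases share this argument.
    eliminate : ∀ {n} V x t {ss ts : Vec Term n} →
                (∀ {ss ts : Vec Term n} → varsᵗˢ ss ⊆ V ⟍ x → varsᵗˢ ts ⊆ V ⟍ x →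
                 Solves N v ss ts → ¬ ¬ Mgu ss ts) →
                t ≢ var x → varsᵗ t ⊆ V → varsᵗˢ ss ⊆ V → varsᵗˢ ts ⊆ V →
                Solves N v (var x ∷ ss) (t ∷ ts) → ¬ ¬ Mgu (var x ∷ ss) (t ∷ ts)
    eliminate V x t {ss} {ts} rec t≢x t⊆V ss⊆V ts⊆V s with mem? _≟_ x (varsᵗ t)
    ... | yes x∈t = λ _ → occurCheck x∈t t≢x v (∷-injectiveˡ s)
    ... | no  x∉t = ¬¬-map (mgu-eliminate x∉t)
          (rec (↦-vars ss x∉t t⊆V ss⊆V) (↦-vars ts x∉t t⊆V ts⊆V)
            (trans (eval-substˢ N e ss) (trans (∷-injectiveʳ s) (sym (eval-substˢ N e ts)))))
      where e = ↦-eval N v (∷-injectiveˡ s)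

    -- Termination is lexicographic: `k` bounds the number of variables that may still occur, `m`
    -- the size of the left side. Elimination, through `unify-below`, lowers `k` and resets `m`;
    -- deleting or decomposing an equation keeps `V` and lowers `m`.
    unify-within : ∀ k m {n} V (ss ts : Vec Term n) → length V < k → sizeˢ ss < m →
                   varsᵗˢ ss ⊆ V → varsᵗˢ ts ⊆ V →
                   Solves N v ss ts → ¬ ¬ Mgu ss ts
    unify-below : ∀ k {n} V x → x ∈ V → length V < k → {ss ts : Vec Term n} →
                  varsᵗˢ ss ⊆ V ⟍ x → varsᵗˢ ts ⊆ V ⟍ x →
                  Solves N v ss ts → ¬ ¬ Mgu ss ts
    unify-within _ _ V [] [] _ _ _ _ _ ¬μ =
      ¬μ record { θ = var ; unifies = refl ; general = λ _ _ _ _ _ → refl }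
    unify-within k (suc m) V (var x ∷ ss) (var y ∷ ts) <k <m ss⊆ ts⊆ s with x ≟ y
    ... | yes refl =
          ¬¬-map (mgu-resp λ _ _ _ → mk⇔ (cong (_ ∷_)) ∷-injectiveʳ)
            (unify-within k m V ss ts <k (s≤s⁻¹ <m) (ss⊆ ∘ there) (ts⊆ ∘ there)
              (∷-injectiveʳ s))
    ... | no x≢y =
          eliminate V x (var y) (unify-below k V x (ss⊆ (here refl)) <k) (λ { refl → x≢y refl })
            (ts⊆ ∘ ∈-++⁺ˡ) (ss⊆ ∘ there) (ts⊆ ∘ there) s
    unify-within k m V (var x ∷ ss) (fn g ws ∷ ts) <k <m ss⊆ ts⊆ s =
      eliminate V x (fn g ws) (unify-below k V x (ss⊆ (here refl)) <k) (λ ())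
        (ts⊆ ∘ ∈-++⁺ˡ) (ss⊆ ∘ there) (ts⊆ ∘ ∈-++⁺ʳ (varsᵗˢ ws)) s
    unify-within k m V (fn f us ∷ ss) (var x ∷ ts) <k <m ss⊆ ts⊆ s =
      ¬¬-map (mgu-resp λ _ _ _ → mk⇔ swap swap)
        (eliminate V x (fn f us) (unify-below k V x (ts⊆ (here refl)) <k) (λ ())
          (ss⊆ ∘ ∈-++⁺ˡ) (ss⊆ ∘ ∈-++⁺ʳ (varsᵗˢ us)) (ts⊆ ∘ there) (swap s))
      where
      swap : ∀ {a} {A : Set a} {n} {x y : A} {xs ys : Vec A n} →
             x ∷ xs ≡ y ∷ ys → y ∷ xs ≡ x ∷ ys
      swap refl = refl
    unify-within k (suc m) V (fn f us ∷ ss) (fn g ws ∷ ts) <k <m ss⊆ ts⊆ s ¬μ =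
      -- `distinct` closes the case `f ≢ g`; as the goal is `⊥`, the case of equal symbols can be
      -- treated inside the proof of `f ≢ g` that it asks for.
      distinct (λ where
        refl → ¬¬-map (mgu-resp λ N′ inj w → mk⇔ (compose N′ us ws) (decompose N′ inj us ws))
          (unify-within k m V (us Vec.++ ss) (ws Vec.++ ts) <k
            (subst (_< m) (sym (sizeˢ-++ us ss)) (s≤s⁻¹ <m))
            (ss⊆ ∘ varsᵗˢ-++⁻ us) (ts⊆ ∘ varsᵗˢ-++⁻ ws)
            (decompose N injective us ws s)) ¬μ)
        _ _ (∷-injectiveˡ s)
      where
      compose : ∀ N′ {w n f} (us ws : Vec Term (functionArity f)) {ss ts : Vec Term n} →
                Solves N′ w (us Vec.++ ss) (ws Vec.++ ts) →
                Solves N′ w (fn f us ∷ ss) (fn f ws ∷ ts)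
      compose N′ us ws {ss} {ts} eq = cong₂ _∷_
        (cong (Structure.⟦_⟧ᶠ N′ _) (++-injectiveˡ (evalᵗˢ N′ _ us) _ eq′))
        (++-injectiveʳ (evalᵗˢ N′ _ us) _ eq′)
        where eq′ = trans (sym (eval-++ N′ us ss)) (trans eq (eval-++ N′ ws ts))
      decompose : ∀ N′ → Injective N′ → ∀ {w n f} (us ws : Vec Term (functionArity f))
                  {ss ts : Vec Term n} → Solves N′ w (fn f us ∷ ss) (fn f ws ∷ ts) →
                  Solves N′ w (us Vec.++ ss) (ws Vec.++ ts)
      decompose N′ inj us ws {ss} {ts} eq =
        trans (eval-++ N′ us ss)
          (trans (cong₂ Vec._++_ (inj _ (∷-injectiveˡ eq)) (∷-injectiveʳ eq))
            (sym (eval-++ N′ ws ts)))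

    unify-below (suc k) V x x∈V <k {ss} {ts} ss⊆ ts⊆ =
      unify-within k (suc (sizeˢ ss)) (V ⟍ x) ss ts
        (≤-trans (filter-notAll _ V (Any.map (λ { refl x≢x → x≢x refl }) x∈V)) (s≤s⁻¹ <k))
        ≤-refl ss⊆ ts⊆

    unify : ∀ {n} (ss ts : Vec Term n) → Solves N v ss ts → ¬ ¬ Mgu ss ts
    unify ss ts = unify-within _ _ (varsᵗˢ ss ++ varsᵗˢ ts) ss ts ≤-refl ≤-refl
      ∈-++⁺ˡ (∈-++⁺ʳ (varsᵗˢ ss))

-- Truth of resolvents and soundness of finite failure.

module Soundness (𝓛 : Language) where

  open Language 𝓛
  open LogicPrograms 𝓛
  open Substitutions 𝓛
  open Unification 𝓛 using (Mgu; module Mgu; herbrand-injective; unify)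

  rel : Literal → Relation
  rel = relation ∘ atomOf

  rel-subst : ∀ L {σ} → rel (L [ σ ]ˡ) ≡ rel L
  rel-subst (pos A) = refl
  rel-subst (neg A) = refl

  atomOf-subst : ∀ L {σ} → atomOf (L [ σ ]ˡ) ≡ atomOf L [ σ ]ᵃ
  atomOf-subst (pos A) = refl
  atomOf-subst (neg A) = refl

  substˡ-subst : ∀ {σ τ} L → L [ σ ]ˡ [ τ ]ˡ ≡ L [ σ ⨟ τ ]ˡ
  substˡ-subst (pos (p ∙ ts)) = cong (λ us → pos (p ∙ us)) (subst-substˢ ts)
  substˡ-subst (neg (p ∙ ts)) = cong (λ us → neg (p ∙ us)) (subst-substˢ ts)

  substᵠ-subst : ∀ {σ τ} Q → Q [ σ ]ᵠ [ τ ]ᵠ ≡ Q [ σ ⨟ τ ]ᵠ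
  substᵠ-subst []      = refl
  substᵠ-subst (L ∷ Q) = cong₂ _∷_ (substˡ-subst L) (substᵠ-subst Q)

  substᵃ-subst : ∀ {σ τ} A → A [ σ ]ᵃ [ τ ]ᵃ ≡ A [ σ ⨟ τ ]ᵃ
  substᵃ-subst (p ∙ ts) = cong (p ∙_) (subst-substˢ ts)

  substᵃ-cong : ∀ {σ τ} A → (∀ x → σ x ≡ τ x) → A [ σ ]ᵃ ≡ A [ τ ]ᵃ
  substᵃ-cong (p ∙ ts) h = cong (p ∙_) (subst-cong ts λ {x} _ → h x)

  substᵃ-var : ∀ A → A [ var ]ᵃ ≡ A
  substᵃ-var (p ∙ ts) = cong (p ∙_) (subst-var ts)

  substᵠ-pointwise-var : ∀ {σ} Q → (∀ x → σ x ≡ var x) → Q [ σ ]ᵠ ≡ Q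
  substᵠ-pointwise-var []          h = refl
  substᵠ-pointwise-var (pos A ∷ Q) h =
    cong₂ _∷_ (cong pos (trans (substᵃ-cong A h) (substᵃ-var A))) (substᵠ-pointwise-var Q h)
  substᵠ-pointwise-var (neg A ∷ Q) h =
    cong₂ _∷_ (cong neg (trans (substᵃ-cong A h) (substᵃ-var A))) (substᵠ-pointwise-var Q h)

  substᶜ-subst : ∀ {σ τ} c → c [ σ ]ᶜ [ τ ]ᶜ ≡ c [ σ ⨟ τ ]ᶜ
  substᶜ-subst (H ⟵ 𝐁) = cong₂ _⟵_ (substᵃ-subst H) (substᵠ-subst 𝐁)

  ground-subst : ∀ {A σ} → Ground A → A [ σ ]ᵃ ≡ A
  ground-subst {p ∙ ts} g = cong (p ∙_) (trans
    (subst-cong ts λ x∈ → case subst (_ ∈_) g x∈ of λ ()) (subst-var ts))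

  vars-substᵠ : ∀ {σ y} Q → y ∈ varsᵠ (Q [ σ ]ᵠ) → ∃[ x ] x ∈ varsᵠ Q × y ∈ varsᵗ (σ x)
  vars-substᵠ {σ} {y} (L ∷ Q) y∈ =
    [ in-literal , in-query ]′ (∈-++⁻ (varsᵃ (atomOf (L [ σ ]ˡ))) y∈)
    where
    in-literal : y ∈ varsᵃ (atomOf (L [ σ ]ˡ)) → ∃[ x ] x ∈ varsᵠ (L ∷ Q) × y ∈ varsᵗ (σ x)
    in-literal y∈L =
      let x , x∈ , y∈σx = vars-subst (arguments (atomOf L))
                            (subst (λ A → y ∈ varsᵃ A) (atomOf-subst L) y∈L)
      in x , ∈-++⁺ˡ x∈ , y∈σx
    in-query : y ∈ varsᵠ (Q [ σ ]ᵠ) → ∃[ x ] x ∈ varsᵠ (L ∷ Q) × y ∈ varsᵗ (σ x)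
    in-query y∈Q =
      let x , x∈ , y∈σx = vars-substᵠ Q y∈Q in x , ∈-++⁺ʳ (varsᵃ (atomOf L)) x∈ , y∈σx

  vars-substᶜ : ∀ {σ y} c → y ∈ varsᶜ (c [ σ ]ᶜ) → ∃[ x ] x ∈ varsᶜ c × y ∈ varsᵗ (σ x)
  vars-substᶜ (H ⟵ 𝐁) = vars-substᵠ (pos H ∷ 𝐁)

  module _ (M : Structure) where

    open Structure M

    true-cong : ∀ {v w} L → (∀ {x} → x ∈ varsᵃ (atomOf L) → v x ≡ w x) →
                TrueLiteral M v L → TrueLiteral M w L
    true-cong (pos (p ∙ ts)) h = subst ⟦ p ⟧ʳ (eval-congˢ M ts h)
    true-cong (neg (p ∙ ts)) h = _∘ subst ⟦ p ⟧ʳ (sym (eval-congˢ M ts h))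

    true-congᵠ : ∀ {v w} Q → (∀ {x} → x ∈ varsᵠ Q → v x ≡ w x) →
                 TrueQuery M v Q → TrueQuery M w Q
    true-congᵠ []      h []      = []
    true-congᵠ (L ∷ Q) h (l ∷ q) = true-cong L (h ∘ ∈-++⁺ˡ) l ∷
      true-congᵠ Q (h ∘ ∈-++⁺ʳ (varsᵃ (atomOf L))) q

    -- An equality of sets instead of an equivalence, so that the negative case is a congruence and
    -- `subst` transports both ways.
    true-subst : ∀ {v w σ} → (∀ x → evalᵗ M v (σ x) ≡ w x) → ∀ L →
                 TrueLiteral M v (L [ σ ]ˡ) ≡ TrueLiteral M w L
    true-subst h (pos (p ∙ ts)) = cong ⟦ p ⟧ʳ (eval-substˢ M h ts)
    true-subst h (neg (p ∙ ts)) = cong (¬_ ∘ ⟦ p ⟧ʳ) (eval-substˢ M h ts)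

    true-subst⁻ : ∀ {v w σ} → (∀ x → evalᵗ M v (σ x) ≡ w x) → ∀ Q →
                  TrueQuery M v (Q [ σ ]ᵠ) → TrueQuery M w Q
    true-subst⁻ h []      []      = []
    true-subst⁻ h (L ∷ Q) (l ∷ q) = subst (λ X → X) (true-subst h L) l ∷ true-subst⁻ h Q q

    true-subst⁺ : ∀ {v w σ} → (∀ x → evalᵗ M v (σ x) ≡ w x) → ∀ Q →
                  TrueQuery M w Q → TrueQuery M v (Q [ σ ]ᵠ)
    true-subst⁺ h []      []      = []
    true-subst⁺ h (L ∷ Q) (l ∷ q) =
      subst (λ X → X) (sym (true-subst h L)) l ∷ true-subst⁺ h Q q

  module _ {P A 𝐋 Q′} (r : PositiveResolvent P A 𝐋 Q′) where

    open PositiveResolvent r renaming (resolvent to resolvent-≡)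

    renaming′ : Substitution
    renaming′ = proj₁ (proj₁ isVariant)

    variant-instance : variant ≡ clause [ renaming′ ]ᶜ
    variant-instance = proj₂ (proj₁ isVariant)

    head-relation : relation (head clause) ≡ relation A
    head-relation = trans (cong (relation ∘ head) (sym variant-instance))
                          (sym (cong relation (IsMgu.unifies isMgu)))

    -- The literals of a resolvent are instances of literals of the clause body and of `𝐋`. Used
    -- with `Negated`, `Completed` and `Foreign`.
    resolvent-All : {Ψ : Literal → Set} → (∀ L {σ} → Ψ L → Ψ (L [ σ ]ˡ)) →
                    All Ψ (body clause) → All Ψ 𝐋 → All Ψ Q′
    resolvent-All {Ψ} closed Ψ𝐁 Ψ𝐋 = subst (All Ψ) (sym resolvent-≡)
      (Allₚ.map⁺ (All.map (closed _) (Allₚ.++⁺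
        (subst (All Ψ ∘ body) (sym variant-instance) (Allₚ.map⁺ (All.map (closed _) Ψ𝐁)))
        Ψ𝐋)))

    -- Under `evalᵗ M v ∘ θ` the body of the variant holds, so its head holds in the model, and `θ`
    -- makes the head equal to `A`.
    resolvent-sound : ∀ M → IsModel M P → ∀ v → TrueQuery M v Q′ →
                      TrueQuery M (evalᵗ M v ∘ θ) (pos A ∷ 𝐋)
    resolvent-sound M model v q =
      subst id (true-subst M (λ _ → refl) (pos A))
        (subst (TrueAtom M v) (sym (IsMgu.unifies isMgu))
          (subst id (sym (true-subst M (λ _ → refl) (pos (head variant)))) head-true))
      ∷ proj₂ q′
      where
      w : Assignment M
      w = evalᵗ M v ∘ θ
      q′ : TrueQuery M w (body variant) × TrueQuery M w 𝐋
      q′ = Allₚ.++⁻ (body variant)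
        (true-subst⁻ M (λ _ → refl) (body variant ++ 𝐋) (subst (TrueQuery M v) resolvent-≡ q))
      head-true : TrueAtom M w (head variant)
      head-true = subst (TrueAtom M w ∘ head) (sym variant-instance)
        (subst id (sym (true-subst M (λ _ → refl) (pos (head clause))))
          (model clause∈P _ (true-subst⁻ M (λ _ → refl) (body clause)
            (subst (TrueQuery M w ∘ body) variant-instance (proj₁ q′)))))

  module _ {P : Program} (M : Structure) (complete : IsCompleteModel M P) where

    open Structure M
    open IsCompleteModel complete
    open FreeEquality freeEquality

    Negated : Literal → Set
    Negated L = Neg* P (rel L)

    negated-subst : ∀ L {σ} → Negated L → Negated (L [ σ ]ˡ)
    negated-subst L = subst (Neg* P) (sym (rel-subst L))

    -- A body relation is one `RefersTo` step further along the dependency path, so the completion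
    -- remains available throughout a tree.
    negated-body : ∀ {c} → c ∈ P → Neg* P (relation (head c)) → All Negated (body c)
    negated-body c∈P (q , q-neg , q⇒) = All.tabulate λ L∈ →
      q , q-neg , q⇒ ◅◅ ((_ , c∈P , refl , _ , L∈ , refl) ◅ ε)

    -- Merges an assignment for the variables of the query, all below `n`, with one for the clause,
    -- whose variables a shift moves to `n` and above.
    splice : ℕ → Assignment M → Assignment M → Assignment M
    splice n v v′ x with x <? n
    ... | yes _ = v x
    ... | no  _ = v′ (x ∸ n)

    splice-< : ∀ {n v v′ x} → x < n → v x ≡ splice n v v′ x
    splice-< {n} {x = x} x<n with x <? n
    ... | yes _  = refl
    ... | no x≮n = contradiction x<n x≮n

    splice-+ : ∀ n {v v′} x → splice n v v′ (n + x) ≡ v′ x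
    splice-+ n {v′ = v′} x with (n + x) <? n
    ... | yes n+x<n = contradiction n+x<n (m+n≮m n x)
    ... | no _      = cong v′ (m+n∸m≡n n x)

    -- A solution of A ∧ 𝐋 in the completion comes from a clause whose head,
    -- renamed apart by a shift of its variables, unifies with A.
    completed-resolvent : ∀ {A 𝐋 v} → Neg* P (relation A) → TrueQuery M v (pos A ∷ 𝐋) →
      ¬ ¬ (∃[ Q′ ] PositiveResolvent P A 𝐋 Q′ × (∃[ w ] TrueQuery M w Q′))
    completed-resolvent {p ∙ us} {𝐋} {v} p* (a ∷ l)
      with Equivalence.to (completion p p* (evalᵗˢ M v us)) a
    ... | ts , 𝐁 , (c∈P , _) , v′ , eq , 𝐁-true = ¬¬-map resolve
          (unify M freeEquality w us (ts [ shift ]ᵗˢ) solves)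
      where
      vs : List Var
      vs = varsᵠ (pos (p ∙ us) ∷ 𝐋)
      n : ℕ
      n = suc (max 0 vs)
      shift : Substitution
      shift x = var (n + x)
      c : Clause
      c = p ∙ ts ⟵ 𝐁
      w : Assignment M
      w = splice n v v′
      vs<n : ∀ {x} → x ∈ vs → x < n
      vs<n x∈ = s≤s (All.lookup (xs≤max 0 vs) x∈)
      v-w : ∀ {x} → x ∈ vs → v x ≡ w x
      v-w x∈ = splice-< (vs<n x∈)
      w-shift : ∀ x → w (n + x) ≡ v′ x
      w-shift = splice-+ n
      us-eval : evalᵗˢ M w us ≡ evalᵗˢ M v us
      us-eval = eval-congˢ M us (sym ∘ v-w ∘ ∈-++⁺ˡ)
      solves : evalᵗˢ M w us ≡ evalᵗˢ M w (ts [ shift ]ᵗˢ)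
      solves = trans us-eval (trans eq (sym (eval-substˢ M w-shift ts)))
      apart : Disjoint (varsᶜ (c [ shift ]ᶜ)) vs
      apart (y∈c , y∈vs) = case vars-substᶜ c y∈c of λ where
        (x , _ , here refl) → m+n≮m n x (vs<n y∈vs)
      resolve : Mgu us (ts [ shift ]ᵗˢ) →
                ∃[ Q′ ] PositiveResolvent P (p ∙ us) 𝐋 Q′ × (∃[ w ] TrueQuery M w Q′)
      resolve μ = _ , record
        { clause       = c
        ; clause∈P     = c∈P
        ; variant      = c [ shift ]ᶜ
        ; isVariant    = (shift , refl) , (λ x → var (x ∸ n)) , sym unshift
        ; renamedApart = apart
        ; θ            = θ
        ; isMgu        = record
          { unifies     = cong (p ∙_) (as-subst unifies)
          ; mostGeneral = λ σ σ-unifies → σ , λ x → trans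
              (general Herbrand herbrand-injective σ (as-eval (args-≡ σ-unifies)) x)
              (subst-as-eval (θ x))
          }
        ; resolvent    = refl
        -- Since `w` solves the equation in `M`, generality of the mgu gives
        -- `w x ≡ evalᵗ M w (θ x)`; hence `w` itself satisfies the resolvent.
        } , w , true-subst⁺ M (λ x → sym (general M injective w solves x))
                  (𝐁 [ shift ]ᵠ ++ 𝐋)
                  (Allₚ.++⁺ (true-subst⁺ M w-shift 𝐁 𝐁-true)
                    (true-congᵠ M 𝐋 (v-w ∘ ∈-++⁺ʳ (varsᵗˢ us)) l))
        where
        open Mgu μ
        as-subst : ∀ {n σ} {ss ts : Vec Term n} →
                   evalᵗˢ Herbrand σ ss ≡ evalᵗˢ Herbrand σ ts → ss [ σ ]ᵗˢ ≡ ts [ σ ]ᵗˢ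
        as-subst e = trans (sym (subst-as-evalˢ _)) (trans e (subst-as-evalˢ _))
        as-eval : ∀ {n σ} {ss ts : Vec Term n} →
                  ss [ σ ]ᵗˢ ≡ ts [ σ ]ᵗˢ → evalᵗˢ Herbrand σ ss ≡ evalᵗˢ Herbrand σ ts
        as-eval e = trans (subst-as-evalˢ _) (trans e (sym (subst-as-evalˢ _)))
        args-≡ : ∀ {p ss ts} → _≡_ {A = Atom} (p ∙ ss) (p ∙ ts) → ss ≡ ts
        args-≡ refl = refl
        unshift : c [ shift ]ᶜ [ (λ x → var (x ∸ n)) ]ᶜ ≡ c
        unshift = trans (substᶜ-subst c) (cong₂ _⟵_
          (trans (substᵃ-cong (head c) h) (substᵃ-var (head c))) (substᵠ-pointwise-var 𝐁 h))
          where
          h : ∀ x → (shift ⨟ λ x → var (x ∸ n)) x ≡ var x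
          h x = cong var (m+n∸m≡n n x)

    negated-resolvent : ∀ {A 𝐋 Q′} → PositiveResolvent P A 𝐋 Q′ → Neg* P (relation A) →
                        All Negated 𝐋 → All Negated Q′
    negated-resolvent r A* = resolvent-All r negated-subst
      (negated-body (PositiveResolvent.clause∈P r) (subst (Neg* P) (sym (head-relation r)) A*))

    -- At a positive node a solution would pass to some resolvent by `completed-resolvent`, whose
    -- double negation is harmless because the goal is `⊥`. The failure of a `stop` node is a
    -- success of its subsidiary tree, whence the mutual induction.
    failed-sound : ∀ {Q} (t : LDNFTree P Q) → All Negated Q → FinitelyFailed t →
                   ∀ v → ¬ TrueQuery M v Q
    -- The given assignment is taken at the empty query and pulled back through the mgus of the
    -- branch; resolved negative literals are true by `failed-sound`.
    success-sound : ∀ {Q} (t : LDNFTree P Q) → All Negated Q → HasSuccess t →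
                    Assignment M → ∃[ w ] TrueQuery M w Q
    failed-sound (positive ts) (A* ∷ 𝐋*) ff v q =
      completed-resolvent A* q λ (Q′ , r , w , q′) →
        failed-sound (ts Q′ r) (negated-resolvent r A* 𝐋*) (ff Q′ r) w q′
    failed-sound (continue _ _ _ t) (_ ∷ 𝐋*) ff v (_ ∷ l) = failed-sound t 𝐋* ff v l
    failed-sound (stop g t _) (A* ∷ _) hs v (¬a ∷ _) with success-sound t (A* ∷ []) hs v
    -- `A` is known to be true only under some `w`; being ground, it has no variables on which `v`
    -- and `w` could differ.
    ... | w , a ∷ [] = ¬a (true-cong M (pos _) (λ x∈ → case subst (_ ∈_) g x∈ of λ ()) a)
    success-sound success _ _ v = v , []
    success-sound (positive ts) (A* ∷ 𝐋*) (Q′ , r , hs) v =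
      let w , q′ = success-sound (ts Q′ r) (negated-resolvent r A* 𝐋*) hs v
      in _ , resolvent-sound r M isModel w q′
    success-sound (continue _ t ff t′) (A* ∷ 𝐋*) hs v =
      let w , l = success-sound t′ 𝐋* hs v
      in w , (λ a → failed-sound t (A* ∷ []) ff w (a ∷ [])) ∷ l

-- Well-typedness under resolution.

module Typability (𝓛 : Language) (𝓣 : LogicPrograms.Typing 𝓛) where

  open LogicPrograms 𝓛
  open WellTyping 𝓣
  open Typing 𝓣
  open Substitutions 𝓛
  open Soundness 𝓛

  Valid : Substitution → TypedTerms → Set₁
  Valid θ Γ = All (InstanceMember θ) Γ

  lookup-subst : ∀ {n σ} (ts : Vec Term n) i → Vec.lookup (ts [ σ ]ᵗˢ) i ≡ Vec.lookup ts i [ σ ]ᵗ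
  lookup-subst (t ∷ ts) zero    = refl
  lookup-subst (t ∷ ts) (suc i) = lookup-subst ts i

  valid-positions : ∀ m A {σ θ} → Valid θ (positions m (A [ σ ]ᵃ)) ⇔ Valid (σ ⨟ θ) (positions m A)
  valid-positions m (p ∙ ts) {σ} {θ} = mk⇔
    (λ h → Allₚ.map⁺ (All.map (λ {i} → subst (Member (type p i)) (eq i)) (Allₚ.map⁻ h)))
    (λ h → Allₚ.map⁺ (All.map (λ {i} → subst (Member (type p i)) (sym (eq i))) (Allₚ.map⁻ h)))
    where
    eq : ∀ i → Vec.lookup (ts [ σ ]ᵗˢ) i [ θ ]ᵗ ≡ Vec.lookup ts i [ σ ⨟ θ ]ᵗ
    eq i = trans (cong _[ θ ]ᵗ (lookup-subst ts i)) (subst-subst (Vec.lookup ts i))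

  valid-outputs-++ : ∀ 𝐀 𝐁 {θ} → Valid θ (positiveOutputs (𝐀 ++ 𝐁)) ⇔
                     (Valid θ (positiveOutputs 𝐀) × Valid θ (positiveOutputs 𝐁))
  valid-outputs-++ 𝐀 𝐁 {θ} = mk⇔
    (λ h → Allₚ.++⁻ (positiveOutputs 𝐀) (subst (Valid θ) (concatMap-++ _ 𝐀 𝐁) h))
    (λ (h , k) → subst (Valid θ) (sym (concatMap-++ _ 𝐀 𝐁)) (Allₚ.++⁺ h k))

  valid-outputs : ∀ Q {σ θ} → Valid θ (positiveOutputs (Q [ σ ]ᵠ)) →
                  Valid (σ ⨟ θ) (positiveOutputs Q)
  valid-outputs []          h = []
  valid-outputs (pos A ∷ Q) {σ} h with Allₚ.++⁻ (outputs (A [ σ ]ᵃ)) h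
  ... | a , q = Allₚ.++⁺ (Equivalence.to (valid-positions output A) a) (valid-outputs Q q)
  valid-outputs (neg A ∷ Q) h = valid-outputs Q h

  -- A predicate instead of a list of typed terms: weakening is implication, and instantiating by
  -- `σ` is precomposition with `σ ⨟_`.
  Context : Set₂
  Context = Substitution → Set₁

  anything : Context
  anything _ = ⊤

  _,,_ : Context → Query → Context
  (G ,, 𝐀) θ = G θ × Valid θ (positiveOutputs 𝐀)

  -- G stands for premises shared by all the type judgements of the query, such
  -- as the one on the inputs of the head of a clause.
  WT : Context → Query → Set₁
  WT G []      = ⊤
  WT G (L ∷ Q) = (∀ θ → G θ → Valid θ (inputs (atomOf L))) × WT (G ,, (L ∷ [])) Q

  WT-mono : ∀ {G G′} Q → (∀ {θ} → G′ θ → G θ) → WT G Q → WT G′ Q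
  WT-mono []      f h       = tt
  WT-mono (L ∷ Q) f (i , h) = (λ θ → i θ ∘ f) , WT-mono Q (λ (g , o) → f g , o) h

  WT-subst : ∀ {G G′ σ} Q → (∀ {θ} → G′ θ → G (σ ⨟ θ)) → WT G Q → WT G′ (Q [ σ ]ᵠ)
  WT-subst         []      f h       = tt
  WT-subst {σ = σ} (L ∷ Q) f (i , h) =
    (λ θ g → subst (Valid θ ∘ inputs) (sym (atomOf-subst L))
       (Equivalence.from (valid-positions input (atomOf L)) (i (σ ⨟ θ) (f g)))) ,
    WT-subst Q (λ (g , o) → f g , valid-outputs (L ∷ []) o) h

  WT-++ : ∀ {G} 𝐀 {𝐁} → WT G 𝐀 → WT (G ,, 𝐀) 𝐁 → WT G (𝐀 ++ 𝐁)
  WT-++ []      {𝐁} h       k = WT-mono 𝐁 (_, []) k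
  WT-++ (L ∷ 𝐀) {𝐁} (i , h) k = i , WT-++ 𝐀 h (WT-mono 𝐁
    (λ ((g , o) , os) → g , Equivalence.from (valid-outputs-++ (L ∷ []) 𝐀) (o , os)) k)

  WT-intro : ∀ {G} Q → (∀ 𝐀 L 𝐁 → Q ≡ 𝐀 ++ L ∷ 𝐁 → ∀ θ → (G ,, 𝐀) θ → Valid θ (inputs (atomOf L))) →
             WT G Q
  WT-intro []      h = tt
  WT-intro (L ∷ Q) h =
    (λ θ g → h [] L Q refl θ (g , [])) ,
    WT-intro Q λ 𝐀 L′ 𝐁 eq θ ((g , o) , os) →
      h (L ∷ 𝐀) L′ 𝐁 (cong (L ∷_) eq) θ
        (g , Equivalence.from (valid-outputs-++ (L ∷ []) 𝐀) (o , os))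

  query-WT : ∀ {Q} → WellTypedQuery Q → WT anything Q
  query-WT h = WT-intro _ λ 𝐀 L 𝐁 eq θ (_ , os) → h 𝐀 L 𝐁 eq θ os

  -- Nothing precedes `L`, so its inputs are typed without premises. For a negative `L` this types
  -- the root of its subsidiary tree.
  atom-wellTyped : ∀ L {Q} → WT anything (L ∷ Q) → WellTypedAtom (atomOf L)
  atom-wellTyped L (i , _) []           _ _ refl θ _ = i θ tt
  atom-wellTyped L (i , _) (_ ∷ [])     _ _ ()
  atom-wellTyped L (i , _) (_ ∷ _ ∷ _)  _ _ ()

  body-WT : ∀ {c} → WellTypedClause c → WT (λ θ → Valid θ (inputs (head c))) (body c)
  body-WT h = WT-intro _ λ 𝐀 L 𝐁 eq θ (is , os) →
    WellTypedClause.bodyInputs h 𝐀 L 𝐁 eq θ (Allₚ.++⁺ is os)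

  -- `A` comes first, so its inputs are typed, and with them those of the unified head; this types
  -- the body. The outputs of the head follow from those of the body and replace the outputs of `A`
  -- as premises for `𝐋 ++ 𝐁`. The suffix `𝐁` is kept separate to match `Composition`.
  resolvent-WT : ∀ {P A 𝐋 Q′} 𝐁 → WellTypedProgram P → (r : PositiveResolvent P A 𝐋 Q′) →
                 WT anything (pos A ∷ 𝐋 ++ 𝐁) →
                 WT anything (Q′ ++ 𝐁 [ PositiveResolvent.θ r ]ᵠ)
  resolvent-WT {P} {A} {𝐋} 𝐁 wt r (i , h) =
    subst (WT anything) (sym resolvent-split)
      (WT-++ (body clause [ ρ ]ᵠ [ θ ]ᵠ)
        (WT-subst {G = λ ξ → Valid (ρ ⨟ ξ) (inputs (head clause))} (body clause [ ρ ]ᵠ)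
          (λ {ξ} _ → head-inputs ξ)
          (WT-subst (body clause) id (body-WT (wt clause∈P))))
        (WT-subst (𝐋 ++ 𝐁) (λ (_ , os) → tt , Allₚ.++⁺ (head-outputs os) []) h))
    where
    open PositiveResolvent r renaming (resolvent to resolvent-≡)
    ρ = renaming′ r
    same-atom : A [ θ ]ᵃ ≡ head clause [ ρ ]ᵃ [ θ ]ᵃ
    same-atom = trans (IsMgu.unifies isMgu) (cong (_[ θ ]ᵃ ∘ head) (variant-instance r))
    resolvent-split : _ ++ 𝐁 [ θ ]ᵠ ≡ body clause [ ρ ]ᵠ [ θ ]ᵠ ++ (𝐋 ++ 𝐁) [ θ ]ᵠ
    resolvent-split = trans
      (cong (_++ 𝐁 [ θ ]ᵠ) (trans resolvent-≡ (trans
        (cong (λ c → (body c ++ 𝐋) [ θ ]ᵠ) (variant-instance r))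
        (map-++ _ (body clause [ ρ ]ᵠ) 𝐋))))
      (trans (++-assoc (body clause [ ρ ]ᵠ [ θ ]ᵠ) _ _)
        (cong (body clause [ ρ ]ᵠ [ θ ]ᵠ ++_) (sym (map-++ _ 𝐋 𝐁))))
    head-inputs : ∀ ξ → Valid (ρ ⨟ (θ ⨟ ξ)) (inputs (head clause))
    head-inputs ξ =
      Equivalence.to (valid-positions input (head clause))
        (Equivalence.to (valid-positions input (head clause [ ρ ]ᵃ))
          (subst (Valid ξ ∘ inputs) same-atom
            (Equivalence.from (valid-positions input A) (i (θ ⨟ ξ) tt))))
    head-outputs : ∀ {ξ} → Valid ξ (positiveOutputs (body clause [ ρ ]ᵠ [ θ ]ᵠ)) →
                   Valid (θ ⨟ ξ) (outputs A)
    head-outputs {ξ} os =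
      Equivalence.to (valid-positions output A)
        (subst (Valid ξ ∘ outputs) (sym same-atom)
          (Equivalence.from (valid-positions output (head clause [ ρ ]ᵃ))
            (Equivalence.from (valid-positions output (head clause))
              (WellTypedClause.headOutputs (wt clause∈P) _
                (Allₚ.++⁺ (head-inputs ξ)
                  (valid-outputs (body clause) (valid-outputs (body clause [ ρ ]ᵠ) os)))))))

-- Infinite derivations and their decomposition.

module Derivations (𝓛 : Language) where

  open LogicPrograms 𝓛
  open Soundness 𝓛

  Diverges : Program → Query → Set
  Diverges P Q = ∃[ s ] InfiniteDescendingSequenceFrom (flip (Step P)) s Q

  diverges-step : ∀ {P Q} → Diverges P Q → ∃[ Q′ ] Step P Q Q′ × Diverges P Q′
  diverges-step (s , refl , steps) = s 1 , steps 0 , (s ∘ suc , refl , steps ∘ suc)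

  -- Iterating `next` builds the sequence. `S` may lie in a larger universe than `Diverges`, since
  -- only the queries are kept.
  unfold : ∀ {ℓ P} (S : Query → Set ℓ) → (∀ {Q} → S Q → ∃[ Q′ ] Step P Q Q′ × S Q′) →
           ∀ {Q} → S Q → Diverges P Q
  unfold S next {Q} s =
    proj₁ ∘ state , refl , λ n → proj₁ (proj₂ (next (proj₂ (state n))))
    where
    state : ℕ → ∃[ Q ] S Q
    state zero    = Q , s
    state (suc n) = let Q′ , _ , s′ = next (proj₂ (state n)) in Q′ , s′

  -- From `neg A` alone one either enters the subsidiary tree of `A` or reaches the empty query,
  -- which has no step.
  literal-finite : ∀ {P} L → AllDerivationsFinite P (pos (atomOf L) ∷ []) →
                   AllDerivationsFinite P (L ∷ [])
  literal-finite (pos A) fin = fin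
  literal-finite (neg A) fin d with diverges-step d
  ... | _ , subsidiary _ , d′ = fin d′
  ... | _ , resolvent (negative _ _ _) , d′ with diverges-step d′
  ...   | _ , resolvent () , _

  -- Φ 𝐀 𝐁 is an invariant of the derivation of a query whose part 𝐁 has not
  -- been selected yet.  As long as 𝐀 is nonempty a derivation of 𝐀 ++ 𝐁 steps
  -- as a derivation of 𝐀, so that an infinite one would yield an infinite
  -- derivation of 𝐀 unless 𝐀 is resolved completely.
  module Composition {P : Program} (Φ : Query → Query → Set₁)
    (Φ-positive : ∀ {A 𝐋 𝐁 Q′} (r : PositiveResolvent P A 𝐋 Q′) → Φ (pos A ∷ 𝐋) 𝐁 →
                  Φ Q′ (𝐁 [ PositiveResolvent.θ r ]ᵠ))
    (Φ-negative : ∀ {A 𝐋 𝐁} → Ground A → (t : LDNFTree P (pos A ∷ [])) → FinitelyFailed t →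
                  Φ (neg A ∷ 𝐋) 𝐁 → Φ 𝐋 𝐁)
    (Φ-select : ∀ {L 𝐁} → Φ [] (L ∷ 𝐁) → Φ (L ∷ []) 𝐁)
    (Φ-finite : ∀ {L 𝐁} → Φ [] (L ∷ 𝐁) → AllDerivationsFinite P (pos (atomOf L) ∷ []))
    where

    -- `inside` is for derivations that have entered a subsidiary tree and left the suffix behind.
    -- The length of `𝐁` is the induction measure of `suffix-finite`.
    data Progress (n : ℕ) : Query → Set₁ where
      below  : ∀ {𝐀} 𝐁 → length 𝐁 ≡ n → Φ 𝐀 𝐁 → Diverges P (𝐀 ++ 𝐁) → Progress n 𝐀
      inside : ∀ {Q} → Diverges P Q → Progress n Q

    -- The mgu depends only on `A` and the head of the variant, so the same step is possible without
    -- `𝐁`; a variant renamed apart from the longer query is so from the shorter.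
    split-resolvent : ∀ {A 𝐋 Q′} 𝐁 (r : PositiveResolvent P A (𝐋 ++ 𝐁) Q′) →
      ∃[ Q ] ∃[ r′ ] Q′ ≡ Q ++ 𝐁 [ PositiveResolvent.θ {P} {A} {𝐋} {Q} r′ ]ᵠ
    split-resolvent {A} {𝐋} 𝐁 r =
      _ ,
      record
        { PositiveResolvent r hiding (resolvent; renamedApart)
        ; renamedApart = λ (x∈c , x∈Q) → renamedApart (x∈c ,
            subst (_ ∈_) (sym (concatMap-++ _ (pos A ∷ 𝐋) 𝐁)) (∈-++⁺ˡ x∈Q))
        ; resolvent    = refl
        } ,
      trans resolvent-≡ (trans (cong (_[ θ ]ᵠ) (sym (++-assoc (body variant) 𝐋 𝐁)))
        (map-++ _ (body variant ++ 𝐋) 𝐁))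
      where open PositiveResolvent r renaming (resolvent to resolvent-≡)

    -- Induction on `n`: an infinite derivation of `L ∷ 𝐁`, followed by `progress`, would yield one
    -- of `L` alone, against `Φ-finite`.
    suffix-finite : ∀ n 𝐁 → length 𝐁 ≡ n → Φ [] 𝐁 → AllDerivationsFinite P 𝐁
    progress : ∀ n {Q} → Progress n Q → ∃[ Q′ ] Step P Q Q′ × Progress n Q′

    suffix-finite _       []      _    φ d with diverges-step d
    ... | _ , resolvent () , _
    suffix-finite (suc n) (L ∷ 𝐁) refl φ d =
      literal-finite L (Φ-finite φ) (unfold (Progress n) (progress n) (below 𝐁 refl (Φ-select φ) d))

    progress n (inside d) = let Q′ , step , d′ = diverges-step d in Q′ , step , inside d′
    -- The part `𝐀` is used up and the derivation continues with `𝐁`, which the induction hypothesis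
    -- excludes.
    progress n (below {[]} 𝐁 eq φ d) = contradiction d (suffix-finite n 𝐁 eq φ)
    progress n (below {pos A ∷ 𝐋} 𝐁 refl φ d) with diverges-step d
    ... | _ , resolvent (positive r) , d′ =
          let Q , r′ , eq = split-resolvent 𝐁 r
          in Q , resolvent (positive r′) ,
             below _ (length-map _ 𝐁) (Φ-positive r′ φ) (subst (Diverges P) eq d′)
    progress n (below {neg A ∷ 𝐋} 𝐁 eq φ d) with diverges-step d
    ... | _ , subsidiary g , d′                = _ , subsidiary g , inside d′
    ... | _ , resolvent (negative g t ff) , d′ =
          _ , resolvent (negative g t ff) , below 𝐁 eq (Φ-negative g t ff φ) d′

  -- Derivations that only use clauses of `R`.

  module Restriction {P R : Program} (P-extends-R : P Extends R) where

    Foreign : Literal → Set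
    Foreign L = ¬ (rel L DefinedIn P)

    foreign-subst : ∀ L {σ} → Foreign L → Foreign (L [ σ ]ˡ)
    foreign-subst L = subst (λ p → ¬ (p DefinedIn P)) (sym (rel-subst L))

    foreign-resolvent : ∀ {A 𝐋 Q′} → PositiveResolvent R A 𝐋 Q′ → All Foreign 𝐋 → All Foreign Q′
    foreign-resolvent r = resolvent-All r foreign-subst
      (All.tabulate λ L∈ def → P-extends-R _ def
        (_ , PositiveResolvent.clause∈P r , in-body L∈ refl))

    extend : ∀ {A 𝐋 Q′} → PositiveResolvent R A 𝐋 Q′ → PositiveResolvent (P ++ R) A 𝐋 Q′
    extend r = record { PositiveResolvent r hiding (clause∈P)
                      ; clause∈P = ∈-++⁺ʳ P (PositiveResolvent.clause∈P r) }

    -- The membership proof itself is recovered, because the children of a tree are indexed by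
    -- resolvents containing it and `restrict-resolvent` has to return to the very same child.
    clause-in-R : ∀ P {c} (c∈ : c ∈ P ++ R) → ¬ (relation (head c) DefinedIn P) →
                  ∃[ c∈R ] ∈-++⁺ʳ P {R} c∈R ≡ c∈
    clause-in-R []      c∈          _    = c∈ , refl
    clause-in-R (d ∷ P) (here refl) ¬def = contradiction (d , here refl , refl) ¬def
    clause-in-R (d ∷ P) (there c∈)  ¬def =
      let c∈R , eq = clause-in-R P c∈ λ (c , c∈P , eq) → ¬def (c , there c∈P , eq)
      in c∈R , cong there eq

    restrict-resolvent : ∀ {A 𝐋 Q′} → Foreign (pos A) → (r : PositiveResolvent (P ++ R) A 𝐋 Q′) →
                         ∃[ r′ ] extend r′ ≡ r
    restrict-resolvent A-foreign r =
      let c∈R , eq = clause-in-R P clause∈P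
            (subst (λ p → ¬ (p DefinedIn P)) (sym (head-relation r)) A-foreign)
      in record { PositiveResolvent r hiding (clause∈P) ; clause∈P = c∈R } ,
         cong (λ c∈ → record { PositiveResolvent r hiding (clause∈P) ; clause∈P = c∈ }) eq
      where open PositiveResolvent r using (clause∈P)

    -- Simultaneous with the transfer of failure and success: a `continue` node needs `failed⁺`, a
    -- `stop` node needs `failed⁻`, and both reach success through the failure of `stop` nodes.
    restrict  : ∀ {Q} → All Foreign Q → LDNFTree (P ++ R) Q → LDNFTree R Q
    failed⁺   : ∀ {Q} (fs : All Foreign Q) t → FinitelyFailed t → FinitelyFailed (restrict fs t)
    failed⁻   : ∀ {Q} (fs : All Foreign Q) t → FinitelyFailed (restrict fs t) → FinitelyFailed t
    success⁺  : ∀ {Q} (fs : All Foreign Q) t → HasSuccess t → HasSuccess (restrict fs t)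
    success⁻  : ∀ {Q} (fs : All Foreign Q) t → HasSuccess (restrict fs t) → HasSuccess t

    restrict _        success              = success
    restrict (_ ∷ fs) (positive ts)        =
      positive λ Q′ r → restrict (foreign-resolvent r fs) (ts Q′ (extend r))
    restrict _        (flounder ¬g)        = flounder ¬g
    restrict (f ∷ fs) (continue g t ff t′) =
      continue g (restrict (f ∷ []) t) (failed⁺ (f ∷ []) t ff) (restrict fs t′)
    restrict (f ∷ _)  (stop g t ¬ff)       =
      stop g (restrict (f ∷ []) t) (¬ff ∘ failed⁻ (f ∷ []) t)

    failed⁺ (_ ∷ fs) (positive ts)       ff Q′ r =
      failed⁺ (foreign-resolvent r fs) (ts Q′ (extend r)) (ff Q′ (extend r))
    failed⁺ (_ ∷ fs) (continue _ _ _ t′) ff      = failed⁺ fs t′ ff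
    failed⁺ (f ∷ _)  (stop _ t _)        hs      = success⁺ (f ∷ []) t hs

    failed⁻ (f ∷ fs) (positive ts)       ff Q′ r =
      let r′ , eq = restrict-resolvent f r
      in subst (FinitelyFailed ∘ ts Q′) eq
           (failed⁻ (foreign-resolvent r′ fs) (ts Q′ (extend r′)) (ff Q′ r′))
    failed⁻ (_ ∷ fs) (continue _ _ _ t′) ff      = failed⁻ fs t′ ff
    failed⁻ (f ∷ _)  (stop _ t _)        hs      = success⁻ (f ∷ []) t hs

    success⁺ _        success             _ = _
    success⁺ (f ∷ fs) (positive ts) (Q′ , r , hs) =
      let r′ , eq = restrict-resolvent f r
      in Q′ , r′ , success⁺ (foreign-resolvent r′ fs) (ts Q′ (extend r′))
                     (subst (HasSuccess ∘ ts Q′) (sym eq) hs)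
    success⁺ (_ ∷ fs) (continue _ _ _ t′) hs = success⁺ fs t′ hs

    success⁻ _        success             _ = _
    success⁻ (_ ∷ fs) (positive ts) (Q′ , r , hs) =
      Q′ , extend r , success⁻ (foreign-resolvent r fs) (ts Q′ (extend r)) hs
    success⁻ (_ ∷ _)  (stop _ _ _)    ()
    success⁻ (_ ∷ fs) (continue _ _ _ t′) hs = success⁻ fs t′ hs

    restrict-step : ∀ {Q Q′} → All Foreign Q → Step (P ++ R) Q Q′ → Step R Q Q′ × All Foreign Q′
    restrict-step (f ∷ fs) (resolvent (positive r)) =
      let r′ , _ = restrict-resolvent f r in resolvent (positive r′) , foreign-resolvent r′ fs
    restrict-step (f ∷ fs) (resolvent (negative g t ff)) =
      resolvent (negative g (restrict (f ∷ []) t) (failed⁺ (f ∷ []) t ff)) , fs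
    restrict-step (f ∷ _)  (subsidiary g) = subsidiary g , f ∷ []

    foreign-finite : ∀ {Q} → All Foreign Q → AllDerivationsFinite R Q →
                     AllDerivationsFinite (P ++ R) Q
    foreign-finite fs fin d = fin (unfold (λ Q → All Foreign Q × Diverges (P ++ R) Q)
      (λ (fs , d) → let Q′ , step , d′ = diverges-step d
                        step′ , fs′ = restrict-step fs step
                    in Q′ , step′ , fs′ , d′)
      (fs , d))

-- Termination by induction on levels.

module Termination (𝓛 : Language) (𝓣 : LogicPrograms.Typing 𝓛) where

  open LogicPrograms 𝓛
  open WellTyping 𝓣
  open Language 𝓛
  open Substitutions 𝓛
  open Soundness 𝓛
  open Typability 𝓛 𝓣
  open Derivations 𝓛

  -- Levels exist for ground atoms only; this substitution makes every expression ground.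
  grounding : Substitution
  grounding _ = fn constant (subst (Vec Term) (sym constant-arity) [])

  grounding-vars : ∀ {x y} → y ∉ varsᵗ (grounding x)
  grounding-vars {x} = no-vars (sym constant-arity)
    where
    no-vars : ∀ {n y} (eq : 0 ≡ n) → y ∉ varsᵗˢ (subst (Vec Term) eq [])
    no-vars refl ()

  empty : ∀ {xs : List Var} → (∀ {x} → x ∉ xs) → xs ≡ []
  empty {[]}     h = refl
  empty {x ∷ xs} h = contradiction (here refl) h

  ground-atom : ∀ A → Ground (A [ grounding ]ᵃ)
  ground-atom A = empty λ y∈ →
    let x , _ , y∈x = vars-subst (arguments A) y∈ in grounding-vars {x} y∈x

  module _
    (P R : Program) (wellTyped : WellTypedProgram (P ++ R)) (P-extends-R : P Extends R)
    (M : Structure) (complete : IsCompleteModel M (P ++ R))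
    (∣_∣ : LevelMapping P) (acceptable : Acceptable P ∣_∣ M)
    (bounded : ∀ A → WellTypedAtom A → relation A DefinedIn P → Bounded P ∣_∣ A)
    (R-finite : ∀ Q → WellTypedQuery Q → AllDerivationsFinite R Q)
    where

    open Restriction P-extends-R
    open IsCompleteModel complete using (isModel)

    InstancesBelow : ℕ → Atom → Set
    InstancesBelow n A = ∀ A′ → (∃[ ρ ] atom A′ ≡ A [ ρ ]ᵃ) → ∣ A′ ∣ < n

    instances-bounded : ∀ {A} → WellTypedAtom A → relation A DefinedIn P → ∃[ n ] InstancesBelow n A
    instances-bounded wt def =
      let ns , ∈ns = bounded _ wt def
      in suc (max 0 ns) , λ A′ inst → s≤s (All.lookup (xs≤max 0 ns) (∈ns A′ inst))

    -- `failed-sound` needs the relations of resolved negative literals in `Neg*`; the truth of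
    -- positive ones comes from `M` being a model.
    Completed : Literal → Set
    Completed (pos A) = ⊤
    Completed (neg A) = Neg* (P ++ R) (relation A)

    completed-subst : ∀ L {σ} → Completed L → Completed (L [ σ ]ˡ)
    completed-subst (pos A) _ = tt
    completed-subst (neg A) n = n

    completed-body : ∀ {c} → c ∈ P ++ R → All Completed (body c)
    completed-body {c} c∈ = All.tabulate completed
      where
      completed : ∀ {L} → L ∈ body c → Completed L
      completed {pos A} _  = tt
      completed {neg A} L∈ = _ , (c , c∈ , A , L∈ , refl) , ε

    -- A query 𝐀 ++ 𝐁 derived from the body of c after resolving A with c: 𝐀 stems
    -- from the selected part pre of the body, 𝐁 is an instance of the rest.
    record Active (A : Atom) (c : Clause) (𝐀 𝐁 : Query) : Set₁ where
      field
        σ          : Substitution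
        ρ          : Substitution
        head-≡     : head c [ σ ]ᵃ ≡ A [ ρ ]ᵃ
        pre suf    : Query
        body-≡     : body c ≡ pre ++ suf
        suf-≡      : 𝐁 ≡ suf [ σ ]ᵠ
        typed      : WT anything (𝐀 ++ 𝐁)
        negatives  : All Completed 𝐀
        pre-true   : ∀ v → TrueQuery M v 𝐀 → TrueQuery M (evalᵗ M v ∘ σ) pre

    module _ {A : Atom} {c : Clause} where

      open Active

      -- The mgu is composed onto both `σ` and `ρ`, and `resolvent-sound` carries truth of the new
      -- query back to the old one.
      active-positive : ∀ {B 𝐋 𝐁 Q′} (r : PositiveResolvent (P ++ R) B 𝐋 Q′) →
                        Active A c (pos B ∷ 𝐋) 𝐁 → Active A c Q′ (𝐁 [ PositiveResolvent.θ r ]ᵠ)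
      active-positive {𝐁 = 𝐁} r α = record
        { σ         = σ α ⨟ θ
        ; ρ         = ρ α ⨟ θ
        ; head-≡    = trans (sym (substᵃ-subst (head c)))
                        (trans (cong _[ θ ]ᵃ (head-≡ α)) (substᵃ-subst A))
        ; pre       = pre α
        ; suf       = suf α
        ; body-≡    = body-≡ α
        ; suf-≡     = trans (cong _[ θ ]ᵠ (suf-≡ α)) (substᵠ-subst (suf α))
        ; typed     = resolvent-WT 𝐁 wellTyped r (typed α)
        ; negatives = resolvent-All r completed-subst (completed-body clause∈P)
                        (All.tail (negatives α))
        ; pre-true  = λ v q → true-congᵠ M (pre α)
                        (λ {x} _ → sym (eval-subst M (λ _ → refl) (σ α x)))
                        (pre-true α (evalᵗ M v ∘ θ) (resolvent-sound r M isModel v q))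
        }
        where open PositiveResolvent r using (θ; clause∈P)

      -- Soundness of finite failure enters here: the resolved `neg B` is true under every
      -- assignment.
      active-negative : ∀ {B 𝐋 𝐁} → Ground B → (t : LDNFTree (P ++ R) (pos B ∷ [])) →
                        FinitelyFailed t → Active A c (neg B ∷ 𝐋) 𝐁 → Active A c 𝐋 𝐁
      active-negative {𝐋 = 𝐋} {𝐁} _ t ff α = record
        { Active α hiding (typed; negatives; pre-true)
        ; typed     = WT-mono (𝐋 ++ 𝐁) (_, []) (proj₂ (typed α))
        ; negatives = All.tail (negatives α)
        ; pre-true  = λ v q → pre-true α v
            ((λ b → failed-sound M complete t (All.head (negatives α) ∷ []) ff v (b ∷ [])) ∷ q)
        }

      active-select : c ∈ P → ∀ {L 𝐁} → Active A c [] (L ∷ 𝐁) → Active A c (L ∷ []) 𝐁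
      -- Matching on `suf-≡` exposes `L` as the instance by `σ α` of the next body literal `L₀`,
      -- which moves from `suf` to `pre`.
      active-select c∈P α@record { suf = L₀ ∷ suf′ ; suf-≡ = refl } = record
        { Active α hiding (pre; suf; body-≡; suf-≡; negatives; pre-true)
        ; pre       = pre α ++ L₀ ∷ []
        ; suf       = suf′
        ; body-≡    = trans (body-≡ α) (sym (++-assoc (pre α) (L₀ ∷ []) suf′))
        ; suf-≡     = refl
        ; negatives = completed-subst L₀
            (All.head (Allₚ.++⁻ʳ (pre α) (subst (All Completed) (body-≡ α)
              (completed-body (∈-++⁺ˡ c∈P))))) ∷ []
        ; pre-true  = λ where
            v (l ∷ []) → Allₚ.++⁺ (pre-true α v [])
              (subst id (true-subst M (λ _ → refl) L₀) l ∷ [])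
        }

      -- With `𝐀` empty, `pre-true` makes `pre` true without premises, so acceptability puts `L`
      -- below the head; the head instance is an instance of `A`, whose level is at most `n`.
      active-levels : c ∈ P → ∀ {n L 𝐁} → InstancesBelow (suc n) A → Active A c [] (L ∷ 𝐁) →
                      InstancesBelow n (atomOf L)
      active-levels c∈P below α@record { suf = L₀ ∷ suf′ ; suf-≡ = refl }
        B′@(mkHerbrand B g _) (τ , B-≡) =
        ≤-trans (acceptable A′ B′ (pre α [ δ ]ᵠ) (L₀ [ δ ]ˡ) (suf′ [ δ ]ᵠ) L₀-≡ instance-≡
                   pre-valid)
          (s≤s⁻¹ (below A′ (ρ α ⨟ γ , trans (sym (substᵃ-subst (head c)))
            (trans (cong _[ γ ]ᵃ (head-≡ α)) (substᵃ-subst A)))))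
        where
        -- `τ` makes the literal ground; `grounding` then removes the variables left in the rest of
        -- the clause.
        γ δ : Substitution
        γ = τ ⨟ grounding
        δ = σ α ⨟ γ
        c-ground : varsᶜ (c [ δ ]ᶜ) ≡ []
        c-ground = empty λ y∈ →
          let x , _ , y∈x = vars-substᶜ c y∈
              z , _ , y∈z = vars-substᵗ (σ α x) y∈x
              u , _ , y∈u = vars-substᵗ (τ z) y∈z
          in grounding-vars {u} y∈u
        A′ : HerbrandBase P
        A′ = mkHerbrand (head c [ δ ]ᵃ) (++-conicalˡ _ _ c-ground) (c , c∈P , in-head refl)
        B-ground : Ground B
        -- Groundness is an irrelevant field; decidable equality of variable lists makes it usable.
        B-ground = recompute (≡-dec _≟_ (varsᵃ B) []) g
        L₀-≡ : atomOf (L₀ [ δ ]ˡ) ≡ B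
        L₀-≡ = sym (trans (sym (ground-subst B-ground)) (trans (cong _[ grounding ]ᵃ B-≡)
          (trans (substᵃ-subst (atomOf (L₀ [ σ α ]ˡ))) (trans (cong _[ γ ]ᵃ (atomOf-subst L₀))
            (trans (substᵃ-subst (atomOf L₀)) (sym (atomOf-subst L₀)))))))
        instance-≡ : (head c [ δ ]ᵃ ⟵ pre α [ δ ]ᵠ ++ L₀ [ δ ]ˡ ∷ suf′ [ δ ]ᵠ) ∈ground P
        instance-≡ = c , c∈P , (δ , c-≡) , subst (λ c → varsᶜ c ≡ []) (sym c-≡) c-ground
          where
          c-≡ : (head c [ δ ]ᵃ ⟵ pre α [ δ ]ᵠ ++ L₀ [ δ ]ˡ ∷ suf′ [ δ ]ᵠ) ≡ c [ δ ]ᶜ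
          c-≡ = cong (head c [ δ ]ᵃ ⟵_)
            (sym (trans (cong _[ δ ]ᵠ (body-≡ α)) (map-++ _ (pre α) (L₀ ∷ suf′))))
        pre-valid : _⊨_ M (pre α [ δ ]ᵠ)
        pre-valid v = true-subst⁺ M
          (λ x → eval-subst M (λ _ → refl) (σ α x)) (pre α) (pre-true α (evalᵗ M v ∘ γ) [])

    -- Right after resolving `A`, the whole resolvent counts as unselected suffix.
    resolved-instance : ∀ {A Q′} → WT anything (pos A ∷ []) →
                        (r : PositiveResolvent (P ++ R) A [] Q′) →
                        Active A (PositiveResolvent.clause r) [] Q′
    resolved-instance {A} {Q′} typed r = record
      { σ         = renaming′ r ⨟ θ
      ; ρ         = θ
      ; head-≡    = trans (sym (substᵃ-subst (head clause)))
                      (sym (trans (IsMgu.unifies isMgu)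
                        (cong (_[ θ ]ᵃ ∘ head) (variant-instance r))))
      ; pre       = []
      ; suf       = body clause
      ; body-≡    = refl
      ; suf-≡     = trans resolvent-≡ (trans (cong _[ θ ]ᵠ (trans (++-identityʳ _)
                      (cong body (variant-instance r)))) (substᵠ-subst (body clause)))
      ; typed     = subst (WT anything) (++-identityʳ Q′) (resolvent-WT [] wellTyped r typed)
      ; negatives = []
      ; pre-true  = λ _ _ → []
      }
      where open PositiveResolvent r renaming (resolvent to resolvent-≡)

    undefined-finite : ∀ A → WellTypedAtom A → ¬ (relation A DefinedIn P) →
                       AllDerivationsFinite (P ++ R) (pos A ∷ [])
    undefined-finite A wt ¬def = foreign-finite (¬def ∷ []) (R-finite _ wt)

    -- Induction on the strict bound `n`. It cannot be `0`, because `A` has a ground instance.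
    defined-finite : ∀ n {A} → WT anything (pos A ∷ []) → relation A DefinedIn P →
                     InstancesBelow n A → AllDerivationsFinite (P ++ R) (pos A ∷ [])
    resolvents-finite : ∀ n {A} → WT anything (pos A ∷ []) → relation A DefinedIn P →
                        InstancesBelow (suc n) A →
                        ∀ {Q′} → Step (P ++ R) (pos A ∷ []) Q′ → AllDerivationsFinite (P ++ R) Q′
    defined-finite zero {A} wt (c , c∈P , eq) below _ =
      case below (mkHerbrand (A [ grounding ]ᵃ) (ground-atom A) (c , c∈P , in-head eq))
                 (grounding , refl) of λ ()
    defined-finite (suc n) wt def below d =
      let _ , step , d′ = diverges-step d in resolvents-finite n wt def below step d′

    resolvents-finite n {A} wt def below {Q′} (resolvent (positive r)) =
      suffix-finite (length Q′) Q′ refl (resolved-instance wt r)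
      where
      open PositiveResolvent r using (clause; clause∈P)
      c∈P : clause ∈ P
      -- A clause of `R` would have a relation defined in `P` in its head, against `P Extends R`.
      c∈P = [ id , (λ c∈R → contradiction (clause , c∈R , in-head (head-relation r))
                                          (P-extends-R _ def)) ]′ (∈-++⁻ P clause∈P)
      atom-finite : ∀ {L 𝐁} → Active A clause [] (L ∷ 𝐁) →
                    AllDerivationsFinite (P ++ R) (pos (atomOf L) ∷ [])
      atom-finite {L} α d = ¬¬-excluded-middle λ where
        (yes L-def) → defined-finite n (proj₁ (Active.typed α) , tt) L-def
                        (active-levels c∈P below α) d
        (no ¬L-def) → undefined-finite (atomOf L) (atom-wellTyped L (Active.typed α)) ¬L-def d
      open Composition (Active A clause) active-positive active-negative
        (active-select c∈P) atom-finite

    -- Boundedness supplies the initial bound; from there on acceptability makes it decrease.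
    atom-finite : ∀ L Q → WT anything (L ∷ Q) → AllDerivationsFinite (P ++ R) (pos (atomOf L) ∷ [])
    atom-finite L _ wt d = ¬¬-excluded-middle λ where
        (yes L-def) → let n , below = instances-bounded L-wellTyped L-def
                      in defined-finite n (proj₁ wt , tt) L-def below d
        (no ¬L-def) → undefined-finite (atomOf L) L-wellTyped ¬L-def d
      where
      L-wellTyped : WellTypedAtom (atomOf L)
      L-wellTyped = atom-wellTyped L wt

    -- Invariant for a second use of `Composition`, which passes from atoms to arbitrary queries.
    Typed : Query → Query → Set₁
    Typed 𝐀 𝐁 = WT anything (𝐀 ++ 𝐁)

    typed-positive : ∀ {A 𝐋 𝐁 Q′} (r : PositiveResolvent (P ++ R) A 𝐋 Q′) →
                     Typed (pos A ∷ 𝐋) 𝐁 → Typed Q′ (𝐁 [ PositiveResolvent.θ r ]ᵠ)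
    typed-positive {𝐁 = 𝐁} = resolvent-WT 𝐁 wellTyped

    typed-negative : ∀ {A 𝐋 𝐁} → Ground A → (t : LDNFTree (P ++ R) (pos A ∷ [])) →
                     FinitelyFailed t → Typed (neg A ∷ 𝐋) 𝐁 → Typed 𝐋 𝐁
    typed-negative {𝐋 = 𝐋} {𝐁} _ _ _ (_ , h) = WT-mono (𝐋 ++ 𝐁) (_, []) h

    typed-select : ∀ {L 𝐁} → Typed [] (L ∷ 𝐁) → Typed (L ∷ []) 𝐁
    typed-select h = h

    typed-finite : ∀ {L 𝐁} → Typed [] (L ∷ 𝐁) →
                   AllDerivationsFinite (P ++ R) (pos (atomOf L) ∷ [])
    typed-finite {L} {𝐁} h = atom-finite L 𝐁 h

    query-finite : ∀ Q → WellTypedQuery Q → AllDerivationsFinite (P ++ R) Q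
    query-finite Q wt = suffix-finite (length Q) Q refl (query-WT wt)
      where
      open Composition Typed (λ {A} {𝐋} {𝐁} → typed-positive {A} {𝐋} {𝐁})
        (λ {A} {𝐋} {𝐁} → typed-negative {A} {𝐋} {𝐁}) (λ {L} {𝐁} → typed-select {L} {𝐁})
        (λ {L} {𝐁} → typed-finite {L} {𝐁})

corollary35 : (𝓛 : Language) → let open LogicPrograms 𝓛 in
    (𝓣 : Typing) → let open WellTyping 𝓣 in
    (P R : Program) →
    WellTypedProgram (P ++ R) →
    P Extends R →
    (M : Structure) → IsCompleteModel M (P ++ R) →
    (∣_∣ : LevelMapping P) → Acceptable P ∣_∣ M →
    (∀ A → WellTypedAtom A → relation A DefinedIn P → Bounded P ∣_∣ A) →
    (∀ Q → WellTypedQuery Q → AllDerivationsFinite R Q) →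
    (∀ Q → WellTypedQuery Q → AllDerivationsFinite (P ++ R) Q)
corollary35 = Termination.query-finite
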